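{- Let $n$ be a positive integer and let $b_8(n)$ denote the number of $8$-regular partitions of $n$, i.e. the number of ways to write $n$ as an unordered sum of positive integers none of which is divisible by $8$. Then $b_8(n)$ is odd if and only if \[ 24n+7 = p^{4a+1}m^2 \] for some prime $p$, some positive integer $m$ with $p\nmid m$, and some integer $a\ge 0$. -}

module Defs where

open import Data.Nat using (ℕ; zero; suc; _+_; _*_; _∸_; _%_)
open import Data.Bool using (Bool; true; false; if_then_else_)
open import Data.Nat using (_≡ᵇ_)

-- regCount d k n : the number of partitions of n all of whose parts lie in
-- {1,…,k} and are not divisible by d (d ≥ 1 assumed by the users below).
-- Recursion on the largest allowed part size k: choose the multiplicity j
-- of the part k (j = 0,1,…, while j*k ≤ n), then partition the rest
-- using parts ≤ k-1.  If d ∣ k, only j = 0 is allowed.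
mutual
  regCount : (d : ℕ) → ℕ → ℕ → ℕ
  regCount d zero zero = 1
  regCount d zero (suc n) = 0
  regCount (suc d) (suc k) n =
    if (suc k % suc d) ≡ᵇ 0
    then regCount (suc d) k n
    else multLoop (suc d) k n n
  regCount zero (suc k) n = 0

  -- multLoop d k n fuel: sum over j ≥ 0 with j*(k+1) ≤ n of
  -- regCount d k (n - j*(k+1)); 'fuel' bounds the number of steps
  -- (fuel = n suffices since k+1 ≥ 1).
  multLoop : (d : ℕ) → ℕ → ℕ → ℕ → ℕ
  multLoop d k n zero = regCount d k n
  multLoop d k n (suc fuel) with n Data.Nat.<ᵇ suc k
  ... | true  = regCount d k n
  ... | false = regCount d k n + multLoop d k (n ∸ suc k) fuel

-- b₈(n): number of 8-regular partitions of n (parts ≤ n suffice).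
b8 : ℕ → ℕ
b8 n = regCount 8 n n

-- sanity checks (b₈ agrees with OEIS A113409: 1,1,2,3,5,7,11,15,21,29,40,...)
open import Relation.Binary.PropositionalEquality using (_≡_; refl)
private
  t0 : b8 0 ≡ 1
  t0 = refl
  t8 : b8 8 ≡ 21
  t8 = refl
  t7 : b8 7 ≡ 15
  t7 = refl
  t10 : b8 10 ≡ 40
  t10 = refl
  t9 : b8 9 ≡ 29
  t9 = refl
  t20 : b8 20 ≡ 545
  t20 = refl

{-# OPTIONS --safe #-}
module Submission where

-- Put N = 24n + 7.  Modulo 2 the generating series of b₈ is ∏(1 + q^8i) / ∏(1 + q^i) = ∏(1 + q^4i) · Σ q^(k(k+1)/2),
-- by Gauss' triangular number theorem and the freshman's dream; expanding the product by Euler's pentagonal number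
-- theorem, b₈(n) has the parity of the number of representations N = 3x² + 4y² with x, y > 0.  Both theorems are
-- obtained from Shanks' telescoping finite identities.
--
-- The positive solutions of N = 3x² + 4yz carry two involutions.  Exchanging y and z fixes the representations above.
-- A Zagier-style involution, linear on each of five regions, fixes those with x = y or y = 2x + z, where
-- N = x(3x + 4z) or N = (x + 2z)(3x + 2z); these correspond to the divisors d of N with d² < N.
--
-- Since N is no square, N = p^(2j+1) M with p ∤ M.  Each pair {d, N/d} has exactly one member p^i e with i ≤ j and
-- e ∣ M, so there are (j + 1) τ(M) divisors with d² < N; this is odd iff j is even and M is a square.

open import Defs
open import Data.Empty using (⊥; ⊥-elim)
open import Data.Product using (∃-syntax; _×_; _,_; proj₁; proj₂)
open import Data.Sum using (_⊎_; inj₁; inj₂; [_,_]′)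
open import Relation.Binary using (tri<; tri≈; tri>)
open import Relation.Binary.PropositionalEquality using (_≡_; refl; sym; trans; cong; cong₂; subst; module ≡-Reasoning; subst₂)
open import Relation.Nullary using (Dec; yes; no; does; ¬_)

-- The five maps come from hyperbolic geometry. Attach to (x, y, z) the binary form f(u,v) = z u² +
-- 3x uv - 3y v² of discriminant 3N. For y, z > 0 its roots t = v/u have opposite signs, so the
-- geodesic joining them crosses the side {0,∞} of the ideal hexagon with vertices 0, 1/3, 1/2, 2/3,
-- 1, ∞. It leaves by exactly one other side, because f changes sign once on t > 0. The reflection
-- exchanging that side with {0,∞} yields a new solution with y, z > 0. The values of f at the four
-- inner vertices are, up to constant factors, the linear forms separating the regions; none
-- vanishes, since 3 does not divide N. The reflection may make x negative. Solutions are therefore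
-- identified under (x, y, z) ↦ (-x, z, y), which is induced by the symmetry t ↦ 1/(3t) of the
-- hexagon; as N is odd, x ≠ 0 and each class has one member with x > 0. A class can be fixed in ten
-- ways, by one of five reflections with or without the flip; positivity and congruences modulo 2
-- and 3 leave only the mirrors x = y and y = 2x + z.

module Hexagon where

  open import Data.Fin using (Fin)
  open import Data.Fin.Patterns using (0F; 1F; 2F; 3F; 4F)
  open import Data.Integer using (ℤ; +_; _+_; _*_; -_; _-_; _<_)
  open import Data.Integer.Properties using (_<?_; <-irrefl; <-cmp; +-mono-<; neg-mono-<; +-inverseʳ; +-identityˡ)
  open import Relation.Nullary.Decidable using (_×-dec_)
  open import Data.Integer.Tactic.RingSolver using (solve-∀)

  -- Automorphs of the ternary form 3x² + 4yz

  Triple : Set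
  Triple = ℤ × ℤ × ℤ

  triple≡ : ∀ {x y z x′ y′ z′ : ℤ} → x ≡ x′ → y ≡ y′ → z ≡ z′ → (x , y , z) ≡ (x′ , y′ , z′)
  triple≡ refl refl refl = refl

  Matrix : Set
  Matrix = Triple × Triple × Triple

  Quadratic : Set
  Quadratic = Triple × Triple

  dot : Triple → Triple → ℤ
  dot (a , b , c) (x , y , z) = a * x + b * y + c * z

  column₁ column₂ column₃ : Matrix → Triple
  column₁ ((a , _ , _) , (b , _ , _) , (c , _ , _)) = a , b , c
  column₂ ((_ , a , _) , (_ , b , _) , (_ , c , _)) = a , b , c
  column₃ ((_ , _ , a) , (_ , _ , b) , (_ , _ , c)) = a , b , c

  row×matrix : Triple → Matrix → Triple
  row×matrix v m = dot v (column₁ m) , dot v (column₂ m) , dot v (column₃ m)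

  _·_ : Matrix → Matrix → Matrix
  (u , v , w) · m = row×matrix u m , row×matrix v m , row×matrix w m

  e₁ e₂ e₃ : Triple
  e₁ = + 1 , + 0 , + 0
  e₂ = + 0 , + 1 , + 0
  e₃ = + 0 , + 0 , + 1

  -- 3x² + 4yz; the coefficients are those of x², y², z² and of xy, xz, yz.
  form₀ : Quadratic
  form₀ = (+ 3 , + 0 , + 0) , (+ 0 , + 0 , + 4)

  -- Substitution into `form₀` is carried out on coefficients, so that invariance under a concrete
  -- matrix is a closed computation, settled by `refl` in `pullback-matrix`.
  pullback : Matrix → Quadratic
  pullback ((a , b , c) , (d , e , f) , (g , h , i)) =
    (+ 3 * (a * a) + + 4 * (d * g) , + 3 * (b * b) + + 4 * (e * h) , + 3 * (c * c) + + 4 * (f * i)) ,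
    (+ 6 * (a * b) + + 4 * (d * h + e * g) , + 6 * (a * c) + + 4 * (d * i + f * g) , + 6 * (b * c) + + 4 * (e * i + f * h))

  -- Unfolding integer arithmetic on variables makes conversion checking blow up,
  -- so linear and quadratic forms are opaque and only their closed coefficients compute.
  opaque
    lin : Triple → Triple → ℤ
    lin = dot

    quad : Quadratic → Triple → ℤ
    quad ((a , b , c) , (d , e , f)) (x , y , z) =
      (a * (x * x) + b * (y * y) + c * (z * z)) + (d * (x * y) + e * (x * z) + f * (y * z))

  form : Triple → ℤ
  form = quad form₀

  apply : Matrix → Triple → Triple
  apply (u , v , w) s = lin u s , lin v s , lin w s

  opaque
    unfolding lin

    form-xyz : ∀ x y z → form (x , y , z) ≡ + 3 * (x * x) + + 4 * (y * z)
    form-xyz = eq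
      where
      eq : ∀ x y z → (+ 3 * (x * x) + + 0 * (y * y) + + 0 * (z * z)) + (+ 0 * (x * y) + + 0 * (x * z) + + 4 * (y * z))
                     ≡ + 3 * (x * x) + + 4 * (y * z)
      eq = solve-∀

    lin-apply : ∀ v m s → lin v (apply m s) ≡ lin (row×matrix v m) s
    lin-apply (p , q , r) ((a , b , c) , (d , e , f) , (g , h , i)) (x , y , z) = eq p q r a b c d e f g h i x y z
      where
      eq : ∀ p q r a b c d e f g h i x y z →
           p * (a * x + b * y + c * z) + q * (d * x + e * y + f * z) + r * (g * x + h * y + i * z)
           ≡ (p * a + q * d + r * g) * x + (p * b + q * e + r * h) * y + (p * c + q * f + r * i) * z
      eq = solve-∀

    quad-apply : ∀ m s → form (apply m s) ≡ quad (pullback m) s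
    quad-apply ((a , b , c) , (d , e , f) , (g , h , i)) (x , y , z) =
      trans (form-xyz (a * x + b * y + c * z) (d * x + e * y + f * z) (g * x + h * y + i * z)) (eq a b c d e f g h i x y z)
      where
      eq : ∀ a b c d e f g h i x y z →
           + 3 * ((a * x + b * y + c * z) * (a * x + b * y + c * z)) + + 4 * ((d * x + e * y + f * z) * (g * x + h * y + i * z))
           ≡ ((+ 3 * (a * a) + + 4 * (d * g)) * (x * x) + (+ 3 * (b * b) + + 4 * (e * h)) * (y * y)
                + (+ 3 * (c * c) + + 4 * (f * i)) * (z * z))
             + ((+ 6 * (a * b) + + 4 * (d * h + e * g)) * (x * y) + (+ 6 * (a * c) + + 4 * (d * i + f * g)) * (x * z)
                + (+ 6 * (b * c) + + 4 * (e * i + f * h)) * (y * z))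
      eq = solve-∀

    lin-e₁ : ∀ x y z → lin e₁ (x , y , z) ≡ x
    lin-e₁ = eq
      where
      eq : ∀ x y z → + 1 * x + + 0 * y + + 0 * z ≡ x
      eq = solve-∀

    lin-e₂ : ∀ x y z → lin e₂ (x , y , z) ≡ y
    lin-e₂ = eq
      where
      eq : ∀ x y z → + 0 * x + + 1 * y + + 0 * z ≡ y
      eq = solve-∀

    lin-e₃ : ∀ x y z → lin e₃ (x , y , z) ≡ z
    lin-e₃ = eq
      where
      eq : ∀ x y z → + 0 * x + + 0 * y + + 1 * z ≡ z
      eq = solve-∀

  _⊞_ : Triple → Triple → Triple
  (a , b , c) ⊞ (x , y , z) = a + x , b + y , c + z

  infixl 6 _⊞_

  opaque
    unfolding lin

    lin-⊞ : ∀ u v s → lin u s + lin v s ≡ lin (u ⊞ v) s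
    lin-⊞ (a , b , c) (d , e , f) (x , y , z) = eq a b c d e f x y z
      where
      eq : ∀ a b c d e f x y z → (a * x + b * y + c * z) + (d * x + e * y + f * z) ≡ (a + d) * x + (b + e) * y + (c + f) * z
      eq = solve-∀

    lin-0 : ∀ s → lin (+ 0 , + 0 , + 0) s ≡ + 0
    lin-0 (x , y , z) = eq x y z
      where
      eq : ∀ x y z → + 0 * x + + 0 * y + + 0 * z ≡ + 0
      eq = solve-∀

  apply-apply : ∀ m m′ s → apply m (apply m′ s) ≡ apply (m · m′) s
  apply-apply (u , v , w) m s = triple≡ (lin-apply u m s) (lin-apply v m s) (lin-apply w m s)

  apply-identity : ∀ s → apply (e₁ , e₂ , e₃) s ≡ s
  apply-identity (x , y , z) = triple≡ (lin-e₁ x y z) (lin-e₂ x y z) (lin-e₃ x y z)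

  -- Each is a reflection: the identity plus a product of a column v and a row φ with φ(v) = -2. The
  -- last two rows are, up to sign, the linear forms at the two ends of the side that is exchanged
  -- with {0,∞}. The mirrors φ = 0 are, in order, x = y, 3x + z = 2y, y = 2x + z, y = 3x + 2z and x
  -- + z = 0.
  matrix : Fin 5 → Matrix
  matrix 0F = (- + 1 , + 2 , + 0) , (+ 0 , + 1 , + 0) , (+ 3 , - + 3 , + 1)
  matrix 1F = (- + 5 , + 4 , - + 2) , (- + 3 , + 3 , - + 1) , (+ 6 , - + 4 , + 3)
  matrix 2F = (- + 7 , + 4 , - + 4) , (- + 6 , + 4 , - + 3) , (+ 6 , - + 3 , + 4)
  matrix 3F = (- + 5 , + 2 , - + 4) , (- + 6 , + 3 , - + 4) , (+ 3 , - + 1 , + 3)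
  matrix 4F = (- + 1 , + 0 , - + 2) , (- + 3 , + 1 , - + 3) , (+ 0 , + 0 , + 1)

  flipMatrix : Matrix
  flipMatrix = (- + 1 , + 0 , + 0) , (+ 0 , + 0 , + 1) , (+ 0 , + 1 , + 0)

  move : Fin 5 → Triple → Triple
  move r = apply (matrix r)

  flip : Triple → Triple
  flip = apply flipMatrix

  -- The symmetry t ↦ 1/(3t) fixes the side {0,∞} and reverses the order of the other five.
  dual : Fin 5 → Fin 5
  dual 0F = 4F
  dual 1F = 3F
  dual 2F = 2F
  dual 3F = 1F
  dual 4F = 0F

  matrix-involutive : ∀ r → matrix r · matrix r ≡ (e₁ , e₂ , e₃)
  matrix-involutive 0F = refl
  matrix-involutive 1F = refl
  matrix-involutive 2F = refl
  matrix-involutive 3F = refl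
  matrix-involutive 4F = refl

  matrix-dual : ∀ r → matrix (dual r) · flipMatrix ≡ flipMatrix · matrix r
  matrix-dual 0F = refl
  matrix-dual 1F = refl
  matrix-dual 2F = refl
  matrix-dual 3F = refl
  matrix-dual 4F = refl

  pullback-matrix : ∀ r → pullback (matrix r) ≡ form₀
  pullback-matrix 0F = refl
  pullback-matrix 1F = refl
  pullback-matrix 2F = refl
  pullback-matrix 3F = refl
  pullback-matrix 4F = refl

  move-move : ∀ r s → move r (move r s) ≡ s
  move-move r s = trans (apply-apply (matrix r) (matrix r) s)
    (trans (cong (λ m → apply m s) (matrix-involutive r)) (apply-identity s))

  flip-flip : ∀ s → flip (flip s) ≡ s
  flip-flip s = trans (apply-apply flipMatrix flipMatrix s) (apply-identity s)

  move-dual : ∀ r s → move (dual r) (flip s) ≡ flip (move r s)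
  move-dual r s = trans (apply-apply (matrix (dual r)) flipMatrix s)
    (trans (cong (λ m → apply m s) (matrix-dual r)) (sym (apply-apply flipMatrix (matrix r) s)))

  form-move : ∀ r s → form (move r s) ≡ form s
  form-move r s = trans (quad-apply (matrix r) s) (cong (λ q → quad q s) (pullback-matrix r))

  form-flip : ∀ s → form (flip s) ≡ form s
  form-flip s = quad-apply flipMatrix s

  neg : Triple → Triple
  neg (a , b , c) = - a , - b , - c

  opaque
    unfolding lin

    lin-neg : ∀ v s → lin (neg v) s ≡ - lin v s
    lin-neg (a , b , c) (x , y , z) = eq a b c x y z
      where
      eq : ∀ a b c x y z → - a * x + - b * y + - c * z ≡ - (a * x + b * y + c * z)
      eq = solve-∀

  infix 4 _>0_
  _>0_ : Triple → Triple → Set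
  v >0 s = + 0 < lin v s

  infix 4 _≡0_
  _≡0_ : Triple → Triple → Set
  v ≡0 s = lin v s ≡ + 0

  infixl 5 _⊹_
  -- Inequalities are added on their coefficient rows, which compute. A contradiction is then a
  -- nonnegative combination of hypotheses whose row reduces to zero, and `>0-absurd` closes it
  -- without any ring solving.
  _⊹_ : ∀ {u v s} → u >0 s → v >0 s → u ⊞ v >0 s
  _⊹_ {u} {v} {s} p q = subst (+ 0 <_) (lin-⊞ u v s) (+-mono-< p q)

  infixl 5 _⊹₀_
  _⊹₀_ : ∀ {u v s} → u ≡0 s → v ≡0 s → u ⊞ v ≡0 s
  _⊹₀_ {u} {v} {s} p q = trans (sym (lin-⊞ u v s)) (cong₂ _+_ p q)

  >0-absurd : ∀ {s} → (+ 0 , + 0 , + 0) >0 s → ⊥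
  >0-absurd {s} p = <-irrefl (sym (lin-0 s)) p

  ≡0⇒>0 : ∀ {u v s} → u ≡0 s → v >0 s → u ⊞ v >0 s
  ≡0⇒>0 {u} {v} {s} p q = subst (+ 0 <_) (trans (sym (+-identityˡ _)) (trans (cong (_+ lin v s) (sym p)) (lin-⊞ u v s))) q

  ≡⇒≡0 : ∀ {u v s} → lin u s ≡ lin v s → u ⊞ neg v ≡0 s
  ≡⇒≡0 {u} {v} {s} p = trans (sym (lin-⊞ u (neg v) s))
    (trans (cong₂ _+_ p (lin-neg v s)) (+-inverseʳ (lin v s)))

  sign : ∀ v s → ¬ v ≡0 s → v >0 s ⊎ neg v >0 s
  sign v s v≢0 with <-cmp (+ 0) (lin v s)
  ... | tri< p _ _ = inj₁ p
  ... | tri≈ _ p _ = ⊥-elim (v≢0 (sym p))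
  ... | tri> _ _ p = inj₂ (subst (+ 0 <_) (sym (lin-neg v s)) (neg-mono-< p))

  Positive : Triple → Set
  Positive s = e₂ >0 s × e₃ >0 s

  positive? : ∀ s → Dec (Positive s)
  positive? s = (+ 0 <? lin e₂ s) ×-dec (+ 0 <? lin e₃ s)

  positive-apply : ∀ m s → row×matrix e₂ m >0 s → row×matrix e₃ m >0 s → Positive (apply m s)
  positive-apply m s p q = subst (+ 0 <_) (sym (lin-apply e₂ m s)) p , subst (+ 0 <_) (sym (lin-apply e₃ m s)) q

  apply-positive : ∀ m s → Positive (apply m s) → row×matrix e₂ m >0 s × row×matrix e₃ m >0 s
  apply-positive m s (p , q) = subst (+ 0 <_) (lin-apply e₂ m s) p , subst (+ 0 <_) (lin-apply e₃ m s) q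

  -- For y, z > 0, each of z+3x-3y, 3z+6x-4y, 4z+6x-3y, 3z+3x-y is positive only if the next one is;
  -- their sign patterns are the five regions.
  disjoint : ∀ r r′ s → Positive s → Positive (move r s) → Positive (move r′ s) → r ≡ r′
  disjoint r r′ s (y , z) p q = cases r r′ (apply-positive (matrix r) s p) (apply-positive (matrix r′) s q)
    where
    Region : Fin 5 → Set
    Region r = row×matrix e₂ (matrix r) >0 s × row×matrix e₃ (matrix r) >0 s
    not01 : Region 0F → Region 1F → ⊥
    not01 (_ , b) (a , _) = >0-absurd (b ⊹ a)
    not02 : Region 0F → Region 2F → ⊥
    not02 (_ , b) (a , _) = >0-absurd (b ⊹ b ⊹ z ⊹ y ⊹ y ⊹ a)
    not03 : Region 0F → Region 3F → ⊥
    not03 (_ , b) (a , _) = >0-absurd (b ⊹ b ⊹ z ⊹ z ⊹ y ⊹ y ⊹ y ⊹ a)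
    not04 : Region 0F → Region 4F → ⊥
    not04 (_ , b) (a , _) = >0-absurd (b ⊹ z ⊹ z ⊹ y ⊹ y ⊹ a)
    not12 : Region 1F → Region 2F → ⊥
    not12 (_ , b) (a , _) = >0-absurd (b ⊹ a)
    not13 : Region 1F → Region 3F → ⊥
    not13 (_ , b) (a , _) = >0-absurd (b ⊹ z ⊹ y ⊹ a)
    not14 : Region 1F → Region 4F → ⊥
    not14 (_ , b) (a , _) = >0-absurd (b ⊹ z ⊹ z ⊹ z ⊹ y ⊹ y ⊹ a ⊹ a)
    not23 : Region 2F → Region 3F → ⊥
    not23 (_ , b) (a , _) = >0-absurd (b ⊹ a)
    not24 : Region 2F → Region 4F → ⊥
    not24 (_ , b) (a , _) = >0-absurd (b ⊹ z ⊹ z ⊹ y ⊹ a ⊹ a)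
    not34 : Region 3F → Region 4F → ⊥
    not34 (_ , b) (a , _) = >0-absurd (b ⊹ a)
    cases : ∀ r r′ → Region r → Region r′ → r ≡ r′
    cases 0F 0F p q = refl
    cases 1F 1F p q = refl
    cases 2F 2F p q = refl
    cases 3F 3F p q = refl
    cases 4F 4F p q = refl
    cases 0F 1F p q = ⊥-elim (not01 p q)
    cases 0F 2F p q = ⊥-elim (not02 p q)
    cases 0F 3F p q = ⊥-elim (not03 p q)
    cases 0F 4F p q = ⊥-elim (not04 p q)
    cases 1F 2F p q = ⊥-elim (not12 p q)
    cases 1F 3F p q = ⊥-elim (not13 p q)
    cases 1F 4F p q = ⊥-elim (not14 p q)
    cases 2F 3F p q = ⊥-elim (not23 p q)
    cases 2F 4F p q = ⊥-elim (not24 p q)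
    cases 3F 4F p q = ⊥-elim (not34 p q)
    cases 1F 0F p q = ⊥-elim (not01 q p)
    cases 2F 0F p q = ⊥-elim (not02 q p)
    cases 3F 0F p q = ⊥-elim (not03 q p)
    cases 4F 0F p q = ⊥-elim (not04 q p)
    cases 2F 1F p q = ⊥-elim (not12 q p)
    cases 3F 1F p q = ⊥-elim (not13 q p)
    cases 4F 1F p q = ⊥-elim (not14 q p)
    cases 3F 2F p q = ⊥-elim (not23 q p)
    cases 4F 2F p q = ⊥-elim (not24 q p)
    cases 4F 3F p q = ⊥-elim (not34 q p)

-- Values of the form on walls and mirrors

module FormIdentities where

  open Hexagon
  open import Data.Fin.Patterns using (0F; 2F)
  open import Data.Integer using (+_; _+_; _*_; -_; _-_)
  open import Data.Integer.Properties using (i*j≡0⇒i≡0∨j≡0; i-j≡0⇒i≡j)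
  open import Data.Integer.Tactic.RingSolver using (solve-∀)

  opaque
    unfolding lin

    -- Modulo 3 the form is a multiple of the linear form of each wall, so a solution on a wall
    -- would make 3 divide N. The walls `n₃`, `n₂`, `nₘ`, `n₁` belong to the vertices 1, 2/3, 1/2,
    -- 1/3.
    form-n₃ : ∀ s → ∃[ k ] ∃[ c ] form s ≡ + 3 * k + c * lin (+ 3 , - + 3 , + 1) s
    form-n₃ (x , y , z) = x * x + + 4 * (y * (y - x)) , + 4 * y , trans (form-xyz x y z) (eq x y z)
      where
      eq : ∀ x y z → + 3 * (x * x) + + 4 * (y * z) ≡ + 3 * (x * x + + 4 * (y * (y - x))) + + 4 * y * (+ 3 * x + - + 3 * y + + 1 * z)
      eq = solve-∀

    form-n₂ : ∀ s → ∃[ k ] ∃[ c ] form s ≡ + 3 * k + c * lin (+ 6 , - + 4 , + 3) s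
    form-n₂ (x , y , z) = x * x + z * z + + 2 * (x * z) , - z , trans (form-xyz x y z) (eq x y z)
      where
      eq : ∀ x y z → + 3 * (x * x) + + 4 * (y * z) ≡ + 3 * (x * x + z * z + + 2 * (x * z)) + - z * (+ 6 * x + - + 4 * y + + 3 * z)
      eq = solve-∀

    form-nₘ : ∀ s → ∃[ k ] ∃[ c ] form s ≡ + 3 * k + c * lin (+ 6 , - + 3 , + 4) s
    form-nₘ (x , y , z) = x * x + y * y - + 2 * (x * y) , y , trans (form-xyz x y z) (eq x y z)
      where
      eq : ∀ x y z → + 3 * (x * x) + + 4 * (y * z) ≡ + 3 * (x * x + y * y - + 2 * (x * y)) + y * (+ 6 * x + - + 3 * y + + 4 * z)
      eq = solve-∀

    form-n₁ : ∀ s → ∃[ k ] ∃[ c ] form s ≡ + 3 * k + c * lin (+ 3 , - + 1 , + 3) s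
    form-n₁ (x , y , z) = x * x + + 4 * (z * (z + x)) , - (+ 4 * z) , trans (form-xyz x y z) (eq x y z)
      where
      eq : ∀ x y z → + 3 * (x * x) + + 4 * (y * z) ≡ + 3 * (x * x + + 4 * (z * (z + x))) + - (+ 4 * z) * (+ 3 * x + - + 1 * y + + 3 * z)
      eq = solve-∀

    form-x : ∀ s → ∃[ k ] ∃[ c ] form s ≡ + 2 * k + c * lin e₁ s
    form-x (x , y , z) = + 2 * (y * z) , + 3 * x , trans (form-xyz x y z) (eq x y z)
      where
      eq : ∀ x y z → + 3 * (x * x) + + 4 * (y * z) ≡ + 2 * (+ 2 * (y * z)) + + 3 * x * (+ 1 * x + + 0 * y + + 0 * z)
      eq = solve-∀

    -- Where the middle reflection agrees with the flip, -3x + 2y - 2z vanishes; the identity shows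
    -- that the form is even there, whereas N is odd.
    form-even : ∀ s → ∃[ k ] ∃[ c ] form s ≡ + 2 * k + c * lin (- + 3 , + 2 , - + 2) s
    form-even (x , y , z) = x * (y - z) + + 2 * (y * z) , - x , trans (form-xyz x y z) (eq x y z)
      where
      eq : ∀ x y z → + 3 * (x * x) + + 4 * (y * z) ≡ + 2 * (x * (y - z) + + 2 * (y * z)) + - x * (- + 3 * x + + 2 * y + - + 2 * z)
      eq = solve-∀

    -- On the mirror of `matrix 1F` one has z = 2y - 3x, so the form is 8y² modulo 3, that is 0 or
    -- 2, whereas N is 1 modulo 3. `form-8z²` does the same for `matrix 3F`.
    form-8y² : ∀ s → ∃[ k ] ∃[ y ] ∃[ c ] form s ≡ + 3 * k + + 8 * (y * y) + c * lin (- + 3 , + 2 , - + 1) s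
    form-8y² (x , y , z) = x * x - + 4 * (x * y) , y , - (+ 4 * y) , trans (form-xyz x y z) (eq x y z)
      where
      eq : ∀ x y z → + 3 * (x * x) + + 4 * (y * z) ≡ + 3 * (x * x - + 4 * (x * y)) + + 8 * (y * y) + - (+ 4 * y) * (- + 3 * x + + 2 * y + - + 1 * z)
      eq = solve-∀

    form-8z² : ∀ s → ∃[ k ] ∃[ z ] ∃[ c ] form s ≡ + 3 * k + + 8 * (z * z) + c * lin (- + 6 , + 2 , - + 4) s
    form-8z² (x , y , z) = x * x + + 4 * (x * z) , z , + 2 * z , trans (form-xyz x y z) (eq x y z)
      where
      eq : ∀ x y z → + 3 * (x * x) + + 4 * (y * z) ≡ + 3 * (x * x + + 4 * (x * z)) + + 8 * (z * z) + + 2 * z * (- + 6 * x + + 2 * y + - + 4 * z)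
      eq = solve-∀

    -- The coefficients here and in `sum-≡0` are rows of `matrix 0F` and `matrix 2F` minus the
    -- identity, the shape in which `fixed` delivers the equations of the two surviving mirrors.
    difference-≡0 : ∀ x y z → lin (- + 2 , + 2 , + 0) (x , y , z) ≡ + 0 → x ≡ y
    difference-≡0 x y z p with i*j≡0⇒i≡0∨j≡0 (+ 2) (trans (eq x y z) p)
      where
      eq : ∀ x y z → + 2 * (y - x) ≡ - + 2 * x + + 2 * y + + 0 * z
      eq = solve-∀
    ... | inj₁ ()
    ... | inj₂ q = sym (i-j≡0⇒i≡j y x q)

    sum-≡0 : ∀ x y z → lin (- + 6 , + 3 , - + 3) (x , y , z) ≡ + 0 → y ≡ + 2 * x + z
    sum-≡0 x y z p with i*j≡0⇒i≡0∨j≡0 (+ 3) (trans (eq x y z) p)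
      where
      eq : ∀ x y z → + 3 * (y - (+ 2 * x + z)) ≡ - + 6 * x + + 3 * y + - + 3 * z
      eq = solve-∀
    ... | inj₁ ()
    ... | inj₂ q = i-j≡0⇒i≡j y (+ 2 * x + z) q

    halve-≡0 : ∀ s → lin (- + 6 , + 4 , - + 4) s ≡ + 0 → lin (- + 3 , + 2 , - + 2) s ≡ + 0
    halve-≡0 (x , y , z) p with i*j≡0⇒i≡0∨j≡0 (+ 2) (trans (eq x y z) p)
      where
      eq : ∀ x y z → + 2 * (- + 3 * x + + 2 * y + - + 2 * z) ≡ - + 6 * x + + 4 * y + - + 4 * z
      eq = solve-∀
    ... | inj₁ ()
    ... | inj₂ q = q

    move-0-fixed : ∀ x z → move 0F (x , x , z) ≡ (x , x , z)
    move-0-fixed x z = triple≡ (eq₁ x z) (eq₂ x z) (eq₃ x z)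
      where
      eq₁ : ∀ x z → - + 1 * x + + 2 * x + + 0 * z ≡ x
      eq₁ = solve-∀
      eq₂ : ∀ x z → + 0 * x + + 1 * x + + 0 * z ≡ x
      eq₂ = solve-∀
      eq₃ : ∀ x z → + 3 * x + - + 3 * x + + 1 * z ≡ z
      eq₃ = solve-∀

    move-2-fixed : ∀ x z → move 2F (x , + 2 * x + z , z) ≡ (x , + 2 * x + z , z)
    move-2-fixed x z = triple≡ (eq₁ x z) (eq₂ x z) (eq₃ x z)
      where
      eq₁ : ∀ x z → - + 7 * x + + 4 * (+ 2 * x + z) + - + 4 * z ≡ x
      eq₁ = solve-∀
      eq₂ : ∀ x z → - + 6 * x + + 4 * (+ 2 * x + z) + - + 3 * z ≡ + 2 * x + z
      eq₂ = solve-∀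
      eq₃ : ∀ x z → + 6 * x + - + 3 * (+ 2 * x + z) + + 4 * z ≡ z
      eq₃ = solve-∀

-- The involution on solutions up to flip, and its fixed points

module HexagonInvolution where

  open Hexagon
  open FormIdentities
  open import Data.Fin.Patterns using (0F; 1F; 2F; 3F; 4F)
  open import Data.Fin.Properties using (any?)
  open import Data.Integer using (ℤ; +_; -[1+_]; _+_; _*_; -_; _-_; _<_; ∣_∣)
  open import Data.Integer.Properties using (_≟_; <-irrefl; abs-*; +-identityʳ; *-zeroʳ)
  open import Data.Integer.Tactic.RingSolver using (solve-∀)
  open import Data.Nat using (ℕ; suc)
  open import Data.Nat.Divisibility using (_∣_; _∣?_; divides)
  import Data.Nat.Properties as ℕ
  open import Data.Product.Properties using (≡-dec)
  open import Relation.Nullary.Decidable using (_×-dec_; _⊎-dec_; from-no)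

  Linked : Triple → Triple → Set
  Linked s s′ = Positive s × Positive s′ × ∃[ r ] s′ ≡ move r s

  -- Solutions are considered up to flip, each class being represented by its member with x > 0.
  Paired : Triple → Triple → Set
  Paired s s′ = Linked s s′ ⊎ Linked s (flip s′)

  _≟ₜ_ : (s s′ : Triple) → Dec (s ≡ s′)
  _≟ₜ_ = ≡-dec _≟_ (≡-dec _≟_ _≟_)

  linked? : ∀ s s′ → Dec (Linked s s′)
  linked? s s′ = positive? s ×-dec (positive? s′ ×-dec any? (λ r → s′ ≟ₜ move r s))

  paired? : ∀ s s′ → Dec (Paired s s′)
  paired? s s′ = linked? s s′ ⊎-dec linked? s (flip s′)

  positive-flip : ∀ s → Positive s → Positive (flip s)
  positive-flip s (y , z) = positive-apply flipMatrix s z y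

  linked-sym : ∀ {s s′} → Linked s s′ → Linked s′ s
  linked-sym {s} (p , q , r , refl) = q , p , r , sym (move-move r s)

  linked-flip : ∀ {s s′} → Linked s s′ → Linked (flip s) (flip s′)
  linked-flip {s} {s′} (p , q , r , refl) = positive-flip s p , positive-flip s′ q , dual r , sym (move-dual r s)

  paired-sym : ∀ {s s′} → Paired s s′ → Paired s′ s
  paired-sym (inj₁ l) = inj₁ (linked-sym l)
  paired-sym {s} {s′} (inj₂ l) = inj₂ (subst (λ t → Linked t (flip s)) (flip-flip s′) (linked-flip (linked-sym l)))

  linked-unique : ∀ {s s′ s″} → Linked s s′ → Linked s s″ → s′ ≡ s″
  linked-unique {s} (p , q , r , refl) (_ , q′ , r′ , refl) = cong (λ r → move r s) (disjoint r r′ s p q q′)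

  flip-injective : ∀ {s s′} → flip s ≡ flip s′ → s ≡ s′
  flip-injective {s} {s′} eq = trans (sym (flip-flip s)) (trans (cong flip eq) (flip-flip s′))

  flip-x>0 : ∀ s → (- + 1 , + 0 , + 0) >0 s → e₁ >0 flip s
  flip-x>0 s = subst (+ 0 <_) (sym (lin-apply e₁ flipMatrix s))

  x>0-flip : ∀ s → e₁ >0 flip s → (- + 1 , + 0 , + 0) >0 s
  x>0-flip s = subst (+ 0 <_) (lin-apply e₁ flipMatrix s)

  -- Regions are disjoint, so two partners reached in the same way agree. If one is reached directly
  -- and the other through the flip, then one is the flip of the other, and x and -x would both be
  -- positive.
  paired-unique : ∀ {s s′ s″} → e₁ >0 s′ → e₁ >0 s″ → Paired s s′ → Paired s s″ → s′ ≡ s″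
  paired-unique p q (inj₁ l) (inj₁ l′) = linked-unique l l′
  paired-unique p q (inj₂ l) (inj₂ l′) = flip-injective (linked-unique l l′)
  paired-unique {s″ = s″} p q (inj₁ l) (inj₂ l′) = ⊥-elim (>0-absurd (x>0-flip s″ (subst (e₁ >0_) (linked-unique l l′) p) ⊹ q))
  paired-unique {s′ = s′} p q (inj₂ l) (inj₁ l′) = ⊥-elim (>0-absurd (x>0-flip s′ (subst (e₁ >0_) (linked-unique l′ l) q) ⊹ p))

  multiple-of : ∀ m k {c} → + m * k ≡ c → m ∣ ∣ c ∣
  multiple-of m k refl = divides ∣ k ∣ (trans (abs-* (+ m) k) (ℕ.*-comm m ∣ k ∣))

  vanishing : ∀ a c {b : ℤ} → b ≡ + 0 → a + c * b ≡ a
  vanishing a c refl = trans (cong (λ t → a + t) (*-zeroʳ c)) (+-identityʳ a)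

  opaque
    target : ℕ → ℤ
    target n = + 24 * + n + + 7

    target-def : ∀ n → target n ≡ + 24 * + n + + 7
    target-def n = refl

  3∤target : ∀ n k → ¬ + 3 * k ≡ target n
  3∤target n k p = from-no (3 ∣? 7) (multiple-of 3 (k - + 8 * + n) {+ 7} (trans (eq k (+ n)) (trans (cong (_- + 24 * + n) (trans p (target-def n))) (eq′ (+ n)))))
    where
    eq : ∀ k n → + 3 * (k - + 8 * n) ≡ + 3 * k - + 24 * n
    eq = solve-∀
    eq′ : ∀ n → + 24 * n + + 7 - + 24 * n ≡ + 7
    eq′ = solve-∀

  2∤target : ∀ n k → ¬ + 2 * k ≡ target n
  2∤target n k p = from-no (2 ∣? 7) (multiple-of 2 (k - + 12 * + n) {+ 7} (trans (eq k (+ n)) (trans (cong (_- + 24 * + n) (trans p (target-def n))) (eq′ (+ n)))))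
    where
    eq : ∀ k n → + 2 * (k - + 12 * n) ≡ + 2 * k - + 24 * n
    eq = solve-∀
    eq′ : ∀ n → + 24 * n + + 7 - + 24 * n ≡ + 7
    eq′ = solve-∀

  Residue : ℤ → Set
  Residue y = ∃[ k ] (y * y ≡ + 3 * k ⊎ y * y ≡ + 3 * k + + 1)

  square-mod-3 : ∀ y → Residue y
  square-mod-3 (+ m) = go m
    where
    step : ∀ y → (y + + 3) * (y + + 3) ≡ y * y + + 3 * (+ 2 * y + + 3)
    step = solve-∀
    add₀ : ∀ a b → + 3 * a + + 3 * b ≡ + 3 * (a + b)
    add₀ = solve-∀
    add₁ : ∀ a b → + 3 * a + + 1 + + 3 * b ≡ + 3 * (a + b) + + 1
    add₁ = solve-∀
    next : ∀ y → Residue y → Residue (y + + 3)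
    next y (k , inj₁ p) = k + (+ 2 * y + + 3) , inj₁ (trans (step y) (trans (cong (_+ + 3 * (+ 2 * y + + 3)) p) (add₀ k (+ 2 * y + + 3))))
    next y (k , inj₂ p) = k + (+ 2 * y + + 3) , inj₂ (trans (step y) (trans (cong (_+ + 3 * (+ 2 * y + + 3)) p) (add₁ k (+ 2 * y + + 3))))
    shift : ∀ m → + suc (suc (suc m)) ≡ + m + + 3
    shift m = cong +_ (ℕ.+-comm 3 m)
    go : ∀ m → Residue (+ m)
    go 0 = + 0 , inj₁ refl
    go 1 = + 0 , inj₂ refl
    go 2 = + 1 , inj₂ refl
    go (suc (suc (suc m))) = subst Residue (sym (shift m)) (next (+ m) (go m))
  square-mod-3 -[1+ m ] = square-mod-3 (+ suc m)

  8y²≢target : ∀ n k y → ¬ + 3 * k + + 8 * (y * y) ≡ target n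
  8y²≢target n k y p with square-mod-3 y
  ... | j , inj₁ q = 3∤target n (k + + 8 * j) (trans (eq k j) (trans (cong (λ t → + 3 * k + + 8 * t) (sym q)) p))
    where
    eq : ∀ k j → + 3 * (k + + 8 * j) ≡ + 3 * k + + 8 * (+ 3 * j)
    eq = solve-∀
  -- Here 8y² = 24j + 8, so 3 would divide 7 - 8 = -1.
  ... | j , inj₂ q = from-no (3 ∣? 1) (multiple-of 3 (k + + 8 * j - + 8 * + n) { - + 1} (trans (eq k j (+ n))
                       (trans (cong (λ t → + 3 * k + + 8 * t - + 24 * + n - + 8) (sym q)) (trans (cong (λ t → t - + 24 * + n - + 8) (trans p (target-def n))) (eq′ (+ n))))))
    where
    eq : ∀ k j n → + 3 * (k + + 8 * j - + 8 * n) ≡ + 3 * k + + 8 * (+ 3 * j + + 1) - + 24 * n - + 8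
    eq = solve-∀
    eq′ : ∀ n → + 24 * n + + 7 - + 24 * n - + 8 ≡ - + 1
    eq′ = solve-∀

  3∤form⇒≢0 : ∀ n s v → form s ≡ target n → (∃[ k ] ∃[ c ] form s ≡ + 3 * k + c * lin v s) → ¬ v ≡0 s
  3∤form⇒≢0 n s v s-form (k , c , eq) v≡0 = 3∤target n k (trans (sym (vanishing (+ 3 * k) c v≡0)) (trans (sym eq) s-form))

  2∤form⇒≢0 : ∀ n s v → form s ≡ target n → (∃[ k ] ∃[ c ] form s ≡ + 2 * k + c * lin v s) → ¬ v ≡0 s
  2∤form⇒≢0 n s v s-form (k , c , eq) v≡0 = 2∤target n k (trans (sym (vanishing (+ 2 * k) c v≡0)) (trans (sym eq) s-form))

  8y²-form⇒≢0 : ∀ n s v → form s ≡ target n → (∃[ k ] ∃[ y ] ∃[ c ] form s ≡ + 3 * k + + 8 * (y * y) + c * lin v s) → ¬ v ≡0 s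
  8y²-form⇒≢0 n s v s-form (k , y , c , eq) v≡0 =
    8y²≢target n k y (trans (sym (vanishing (+ 3 * k + + 8 * (y * y)) c v≡0)) (trans (sym eq) s-form))

  x≢0 : ∀ {n s} → form s ≡ target n → ¬ e₁ ≡0 s
  x≢0 {n} {s} s-form = 2∤form⇒≢0 n s e₁ s-form (form-x s)

  -- Along the vertices ∞, 1, 2/3, 1/2, 1/3, 0 the binary form starts negative and ends positive.
  -- The region is located by the first vertex at which it is positive; `sign` applies because no
  -- solution lies on a wall.
  region : ∀ {n s} → form s ≡ target n → Positive s → ∃[ r ] Positive (move r s)
  region {n} {s} s-form (y , z) =
    [ (λ p → 0F , positive-apply (matrix 0F) s y p)
    , (λ p → [ (λ q → 1F , positive-apply (matrix 1F) s p q)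
             , (λ q → [ (λ t → 2F , positive-apply (matrix 2F) s q t)
                      , (λ t → [ (λ u → 3F , positive-apply (matrix 3F) s t u)
                               , (λ u → 4F , positive-apply (matrix 4F) s u z)
                               ]′ (sign (+ 3 , - + 1 , + 3) s (3∤form⇒≢0 n s _ s-form (form-n₁ s))))
                      ]′ (sign (+ 6 , - + 3 , + 4) s (3∤form⇒≢0 n s _ s-form (form-nₘ s))))
             ]′ (sign (+ 6 , - + 4 , + 3) s (3∤form⇒≢0 n s _ s-form (form-n₂ s))))
    ]′ (sign (+ 3 , - + 3 , + 1) s (3∤form⇒≢0 n s _ s-form (form-n₃ s)))

  record Solution (n : ℕ) (s : Triple) : Set where
    field
      x>0      : e₁ >0 s
      positive : Positive s
      form≡    : form s ≡ target n

  open Solution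

  solution-move : ∀ n r s → form s ≡ target n → Positive (move r s) → e₁ >0 move r s → Solution n (move r s)
  solution-move n r s s-form pos x = record { x>0 = x ; positive = pos ; form≡ = trans (form-move r s) s-form }

  solution-flip : ∀ n s → form s ≡ target n → Positive s → neg e₁ >0 s → Solution n (flip s)
  solution-flip n s s-form pos x = record { x>0 = flip-x>0 s x ; positive = positive-flip s pos ; form≡ = trans (form-flip s) s-form }

  -- The reflected solution is the partner if its x is positive; otherwise its flip is, and the
  -- second alternative of `Paired` records this.
  pair : ∀ {n s} → Solution n s → ∃[ s′ ] (Solution n s′ × Paired s s′)
  pair {n} {s} sol = step₁ (region {n} {s} (form≡ sol) (positive sol))
    where
    step₂ : ∀ r → Positive (move r s) → e₁ >0 move r s ⊎ neg e₁ >0 move r s → ∃[ s′ ] (Solution n s′ × Paired s s′)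
    step₂ r pos (inj₁ x) = move r s , solution-move n r s (form≡ sol) pos x , inj₁ (positive sol , pos , r , refl)
    step₂ r pos (inj₂ x) = flip (move r s) , solution-flip n (move r s) (trans (form-move r s) (form≡ sol)) pos x
      , inj₂ (positive sol , subst Positive (sym (flip-flip (move r s))) pos , r , flip-flip (move r s))
    step₁ : ∃[ r ] Positive (move r s) → ∃[ s′ ] (Solution n s′ × Paired s s′)
    step₁ (r , pos) = step₂ r pos (sign e₁ (move r s) (x≢0 {n} {move r s} (trans (form-move r s) (form≡ sol))))

  Diagonal : Triple → Set
  Diagonal (x , y , z) = x ≡ y ⊎ y ≡ + 2 * x + z

  coordinate : ∀ v m {s s′} → apply m s ≡ s′ → lin (row×matrix v m) s ≡ lin v s′
  coordinate v m {s} eq = trans (sym (lin-apply v m s)) (cong (lin v) eq)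

  fixed : ∀ m v {s} → s ≡ apply m s → row×matrix v m ⊞ neg v ≡0 s
  fixed m v {s} eq = ≡⇒≡0 {row×matrix v m} {v} {s} (coordinate v m (sym eq))

  flipped : ∀ m v {s} → flip s ≡ apply m s → row×matrix v m ⊞ neg (row×matrix v flipMatrix) ≡0 s
  flipped m v {s} eq = ≡⇒≡0 {row×matrix v m} {row×matrix v flipMatrix} {s}
    (trans (coordinate v m (sym eq)) (lin-apply v flipMatrix s))

  ≡0-absurd : ∀ {v s} → v ≡0 s → v >0 s → ⊥
  ≡0-absurd p q = <-irrefl (sym p) q

  neg-≡0 : ∀ {v s} → v ≡0 s → neg v ≡0 s
  neg-≡0 {v} {s} p = trans (lin-neg v s) (cong -_ p)

  -- Without the flip, the mirrors of `matrix 1F` and `matrix 3F` contradict N modulo 3, and that of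
  -- `matrix 4F` contradicts x, z > 0. With the flip, `matrix 2F` would make N even and the other
  -- four would force y = 0 or z = 0.
  self-paired⇒diagonal : ∀ {n s} → Solution n s → Paired s s → Diagonal s
  self-paired⇒diagonal {n} {x , y , z} sol (inj₁ (_ , _ , 0F , eq)) = inj₁ (difference-≡0 x y z (fixed (matrix 0F) e₁ eq))
  self-paired⇒diagonal {n} {s} sol (inj₁ (_ , _ , 1F , eq)) =
    ⊥-elim (8y²-form⇒≢0 n s _ (form≡ sol) (form-8y² s) (fixed (matrix 1F) e₂ eq))
  self-paired⇒diagonal {n} {x , y , z} sol (inj₁ (_ , _ , 2F , eq)) = inj₂ (sum-≡0 x y z (fixed (matrix 2F) e₂ eq))
  self-paired⇒diagonal {n} {s} sol (inj₁ (_ , _ , 3F , eq)) =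
    ⊥-elim (8y²-form⇒≢0 n s _ (form≡ sol) (form-8z² s) (fixed (matrix 3F) e₂ eq))
  self-paired⇒diagonal {n} {s} sol (inj₁ (_ , (_ , z) , 4F , eq)) =
    ⊥-elim (>0-absurd (≡0⇒>0 (fixed (matrix 4F) e₁ eq) (x>0 sol ⊹ x>0 sol ⊹ z ⊹ z)))
  self-paired⇒diagonal {n} {s} sol (inj₂ ((y , _) , _ , 0F , eq)) =
    ⊥-elim (≡0-absurd (flipped (matrix 0F) e₁ eq) (y ⊹ y))
  -- The combination 3a + 4b eliminates x and y and leaves 2z = 0.
  self-paired⇒diagonal {n} {s} sol (inj₂ ((_ , z) , _ , 1F , eq)) = ⊥-elim (≡0-absurd (a ⊹₀ a ⊹₀ a ⊹₀ b ⊹₀ b ⊹₀ b ⊹₀ b) (z ⊹ z))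
    where
    a : (- + 4 , + 4 , - + 2) ≡0 s
    a = flipped (matrix 1F) e₁ eq
    b : (+ 3 , - + 3 , + 2) ≡0 s
    b = neg-≡0 (flipped (matrix 1F) e₂ eq)
  self-paired⇒diagonal {n} {s} sol (inj₂ (_ , _ , 2F , eq)) =
    ⊥-elim (2∤form⇒≢0 n s _ (form≡ sol) (form-even s) (halve-≡0 s (flipped (matrix 2F) e₁ eq)))
  -- The combination 3a + 4b eliminates x and z and leaves -2y = 0.
  self-paired⇒diagonal {n} {s} sol (inj₂ ((y , _) , _ , 3F , eq)) = ⊥-elim (>0-absurd (≡0⇒>0 (a ⊹₀ a ⊹₀ a ⊹₀ b ⊹₀ b ⊹₀ b ⊹₀ b) (y ⊹ y)))
    where
    a : (- + 4 , + 2 , - + 4) ≡0 s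
    a = flipped (matrix 3F) e₁ eq
    b : (+ 3 , - + 2 , + 3) ≡0 s
    b = flipped (matrix 3F) e₃ eq
  self-paired⇒diagonal {n} {s} sol (inj₂ ((_ , z) , _ , 4F , eq)) =
    ⊥-elim (>0-absurd (≡0⇒>0 (flipped (matrix 4F) e₁ eq) (z ⊹ z)))

  diagonal⇒self-paired : ∀ {n s} → Solution n s → Diagonal s → Paired s s
  diagonal⇒self-paired {s = x , _ , z} sol (inj₁ refl) = inj₁ (positive sol , positive sol , 0F , sym (move-0-fixed x z))
  diagonal⇒self-paired {s = x , _ , z} sol (inj₂ refl) = inj₁ (positive sol , positive sol , 2F , sym (move-2-fixed x z))

-- Transfer of the involution to natural numbers

module NaturalSolutions where

  open Hexagon
  open FormIdentities
  open HexagonInvolution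
  open import Data.Integer as ℤ using (ℤ; +_; +<+)
  open import Data.Integer.Properties using (pos-*; +-injective)
  open import Data.Nat using (ℕ; _+_; _*_; _<_)

  record IsSolution (n : ℕ) (t : ℕ × ℕ × ℕ) : Set where
    constructor isSolution
    field
      x-pos    : 0 < proj₁ t
      y-pos    : 0 < proj₁ (proj₂ t)
      z-pos    : 0 < proj₂ (proj₂ t)
      equation : 3 * (proj₁ t * proj₁ t) + 4 * (proj₁ (proj₂ t) * proj₂ (proj₂ t)) ≡ 24 * n + 7

  embed : ℕ × ℕ × ℕ → Triple
  embed (x , y , z) = + x , + y , + z

  embed-injective : ∀ {t t′} → embed t ≡ embed t′ → t ≡ t′
  embed-injective refl = refl

  form-embed : ∀ x y z → form (embed (x , y , z)) ≡ + (3 * (x * x) + 4 * (y * z))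
  form-embed x y z = trans (form-xyz (+ x) (+ y) (+ z))
    (cong₂ ℤ._+_ (trans (cong (+ 3 ℤ.*_) (sym (pos-* x x))) (sym (pos-* 3 (x * x))))
                 (trans (cong (+ 4 ℤ.*_) (sym (pos-* y z))) (sym (pos-* 4 (y * z)))))

  target-embed : ∀ n → target n ≡ + (24 * n + 7)
  target-embed n = trans (target-def n) (cong (ℤ._+ + 7) (sym (pos-* 24 n)))

  solution-embed : ∀ {n t} → IsSolution n t → Solution n (embed t)
  solution-embed {n} {x , y , z} (isSolution px py pz eq) = record
    { x>0 = subst (+ 0 ℤ.<_) (sym (lin-e₁ (+ x) (+ y) (+ z))) (+<+ px)
    ; positive = subst (+ 0 ℤ.<_) (sym (lin-e₂ (+ x) (+ y) (+ z))) (+<+ py)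
               , subst (+ 0 ℤ.<_) (sym (lin-e₃ (+ x) (+ y) (+ z))) (+<+ pz)
    ; form≡ = trans (form-embed x y z) (trans (cong +_ eq) (sym (target-embed n))) }

  positive⇒natural : ∀ {i} → + 0 ℤ.< i → ∃[ m ] (0 < m × i ≡ + m)
  positive⇒natural {+ m} (+<+ p) = m , p , refl

  embed-solution : ∀ {n s} → Solution n s → ∃[ t ] (IsSolution n t × s ≡ embed t)
  embed-solution {n} {x , y , z} record { x>0 = px ; positive = (py , pz) ; form≡ = eq }
    with positive⇒natural (subst (+ 0 ℤ.<_) (lin-e₁ x y z) px)
       | positive⇒natural (subst (+ 0 ℤ.<_) (lin-e₂ x y z) py)
       | positive⇒natural (subst (+ 0 ℤ.<_) (lin-e₃ x y z) pz)
  ... | a , pa , refl | b , pb , refl | c , pc , refl =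
    (a , b , c) , isSolution pa pb pc (+-injective (trans (sym (form-embed a b c)) (trans eq (target-embed n)))) , refl

  Partner : ℕ × ℕ × ℕ → ℕ × ℕ × ℕ → Set
  Partner t t′ = Paired (embed t) (embed t′)

  partner? : ∀ t t′ → Dec (Partner t t′)
  partner? t t′ = paired? (embed t) (embed t′)

  partner-sym : ∀ {t t′} → Partner t t′ → Partner t′ t
  partner-sym {t} {t′} = paired-sym {embed t} {embed t′}

  partner-exists : ∀ {n t} → IsSolution n t → ∃[ t′ ] (IsSolution n t′ × Partner t t′)
  partner-exists {n} {t} sol = pull-back (pair (solution-embed sol))
    where
    pull-back : ∃[ s′ ] (Solution n s′ × Paired (embed t) s′) → ∃[ t′ ] (IsSolution n t′ × Partner t t′)
    pull-back (s′ , sol′ , p) = from (embed-solution sol′)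
      where
      from : ∃[ t′ ] (IsSolution n t′ × s′ ≡ embed t′) → ∃[ t′ ] (IsSolution n t′ × Partner t t′)
      from (t′ , q , eq) = t′ , q , subst (Paired (embed t)) eq p

  partner-unique : ∀ {n t t′ t″} → IsSolution n t′ → IsSolution n t″ → Partner t t′ → Partner t t″ → t′ ≡ t″
  partner-unique {t = t} sol′ sol″ p q = embed-injective
    (paired-unique {s = embed t} (Solution.x>0 (solution-embed sol′)) (Solution.x>0 (solution-embed sol″)) p q)

  OnDiagonal : ℕ × ℕ × ℕ → Set
  OnDiagonal (x , y , z) = x ≡ y ⊎ y ≡ 2 * x + z

  partner-self⇒ : ∀ {n t} → IsSolution n t → Partner t t → OnDiagonal t
  partner-self⇒ {n} {x , y , z} sol p = convert (self-paired⇒diagonal (solution-embed sol) p)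
    where
    convert : Diagonal (embed (x , y , z)) → OnDiagonal (x , y , z)
    convert (inj₁ eq) = inj₁ (+-injective eq)
    convert (inj₂ eq) = inj₂ (+-injective (trans eq (cong (ℤ._+ + z) (sym (pos-* 2 x)))))

  partner-self⇐ : ∀ {n t} → IsSolution n t → OnDiagonal t → Partner t t
  partner-self⇐ {n} {x , y , z} sol d = diagonal⇒self-paired (solution-embed sol) (convert d)
    where
    convert : OnDiagonal (x , y , z) → Diagonal (embed (x , y , z))
    convert (inj₁ eq) = inj₁ (cong +_ eq)
    convert (inj₂ eq) = inj₂ (trans (cong +_ eq) (cong (ℤ._+ + z) (pos-* 2 x)))

open import Algebra.Bundles using (module CommutativeRing)
open import Data.Bool using (Bool; true; false; _∧_; _xor_; not; T; if_then_else_)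
open import Data.Bool.Properties using (xor-assoc; xor-comm; xor-same; ∧-distribˡ-xor; ∧-zeroʳ; ∧-identityʳ; ∧-comm; xor-∧-commutativeRing; not-involutive; xor-identityʳ; not-distribˡ-xor)
open import Data.List using (List; []; _∷_; map; filter; cartesianProduct; _++_; upTo; length; foldr)
open import Data.List.Membership.Propositional using (_∈_)
open import Data.List.Membership.Propositional.Properties using (∈-filter⁺; ∈-filter⁻; ∈-upTo⁺; ∈-upTo⁻; ∈-cartesianProduct⁺; ∈-cartesianProduct⁻)
open import Data.List.Properties using (length-upTo)
open import Data.List.Relation.Unary.All using (All; []; _∷_)
open import Data.List.Relation.Unary.AllPairs using (_∷_; [])
open import Data.List.Relation.Unary.Any using (here; there)
open import Data.List.Relation.Unary.Unique.Propositional using (Unique)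
open import Data.List.Relation.Unary.Unique.Propositional.Properties using (filter⁺; upTo⁺; cartesianProduct⁺)
open import Data.Nat using (_<_; ℕ; zero; suc; _+_; _*_; _≤_; z≤n; s≤s; NonZero; >-nonZero; _<?_; _≟_; _%_; _∸_; _^_; _≥_; s≤s⁻¹; >-nonZero⁻¹; nonTrivial⇒n>1; _≤?_; _<ᵇ_; _≡ᵇ_; _/_)
open import Data.Nat.DivMod using (m%n<n; %-distribˡ-*; %-distribˡ-+; [m+kn]%n≡m%n; m≡m%n+[m/n]*n)
open import Data.Nat.Divisibility using (_∣_; divides; _∣?_; m%n≡0⇒n∣m; ∣m+n∣m⇒∣n; m∣m*n; ∣-trans; ∣⇒≤)
open import Data.Nat.Induction using (<-rec)
open import Data.Nat.ListAction using (product)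
open import Data.Nat.Primality using (Prime; prime⇒nonZero; prime⇒nonTrivial; prime⇒irreducible; euclidsLemma; ¬prime[1])
open import Data.Nat.Primality.Factorisation using (factorise)
open import Data.Nat.Properties using (≤-trans; ≤-refl; ≤-reflexive; m≤m*n; m≤n*m; m≤m+n; m≤n+m; *-comm; m<m+n; +-comm; +-suc; <-irrefl; <-trans; *-monoʳ-<; +-monoˡ-≤; +-monoʳ-<; *-cancelˡ-≡; *-cancelʳ-≡; *-cancelˡ-<; +-cancelˡ-≡; +-cancelʳ-≡; +-cancelˡ-<; m*n≢0; *-identityʳ; *-identityˡ; 0≢1+n; <-cmp; *-assoc; ^-distribˡ-+-*; <-asym; ≰⇒>; +-mono-≤; +-cancelˡ-≤; m+[n∸m]≡n; m<m*n; m^n>0; ^-identityʳ; *-mono-<; *-distribʳ-+; *-distribˡ-+; *-zeroʳ; <⇒≤; m+n∸m≡n; <⇒<ᵇ; <ᵇ⇒<; <-≤-connex; m<n+m; m≤n⇒m<n∨m≡n)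
open import Data.Nat.Tactic.RingSolver using (solve-∀)
open import Data.Unit using (tt)
open import Function.Bundles using (_⇔_; mk⇔; module Equivalence)
open import Relation.Nullary.Decidable using (_×-dec_; map′; _⊎-dec_; from-no)
import Data.List.Relation.Unary.All as All
open import Algebra.Properties.CommutativeSemigroup (CommutativeRing.+-commutativeSemigroup xor-∧-commutativeRing) using () renaming (interchange to xor-interchange)

-- Parities of finite counts

module _ {A : Set} where

  ⨁ : List A → (A → Bool) → Bool
  ⨁ []       f = false
  ⨁ (x ∷ xs) f = f x xor ⨁ xs f

  odd# : List A → Bool
  odd# xs = ⨁ xs (λ _ → true)

  ⨁-cong : ∀ xs {f g : A → Bool} → (∀ {x} → x ∈ xs → f x ≡ g x) → ⨁ xs f ≡ ⨁ xs g
  ⨁-cong []       eq = refl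
  ⨁-cong (x ∷ xs) eq = cong₂ _xor_ (eq (here refl)) (⨁-cong xs (λ x∈ → eq (there x∈)))

  ⨁-false : ∀ xs {f : A → Bool} → (∀ {x} → x ∈ xs → f x ≡ false) → ⨁ xs f ≡ false
  ⨁-false []       eq = refl
  ⨁-false (x ∷ xs) eq rewrite eq (here refl) = ⨁-false xs (λ x∈ → eq (there x∈))

  ⨁-∧ : ∀ b xs (f : A → Bool) → ⨁ xs (λ x → b ∧ f x) ≡ b ∧ ⨁ xs f
  ⨁-∧ b []       f = sym (∧-zeroʳ b)
  ⨁-∧ b (x ∷ xs) f = trans (cong (b ∧ f x xor_) (⨁-∧ b xs f)) (sym (∧-distribˡ-xor b (f x) (⨁ xs f)))

  ⨁-++ : ∀ xs ys (f : A → Bool) → ⨁ (xs ++ ys) f ≡ ⨁ xs f xor ⨁ ys f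
  ⨁-++ []       ys f = refl
  ⨁-++ (x ∷ xs) ys f = trans (cong (f x xor_) (⨁-++ xs ys f)) (sym (xor-assoc (f x) _ _))

  ⨁-single : ∀ {xs} → Unique xs → (f : A → Bool) → ∀ {y} → y ∈ xs → f y ≡ true →
             (∀ {x} → x ∈ xs → f x ≡ true → x ≡ y) → ⨁ xs f ≡ true
  ⨁-single {x ∷ xs} (x∉ ∷ u) f (here refl) fy uniq rewrite fy = cong (true xor_) (⨁-false xs zeros)
    where
    zeros : ∀ {z} → z ∈ xs → f z ≡ false
    zeros {z} z∈ with f z in fz
    ... | false = refl
    ... | true  = ⊥-elim (All.lookup x∉ z∈ (sym (uniq (there z∈) fz)))
  ⨁-single {x ∷ xs} (x∉ ∷ u) f (there y∈) fy uniq with f x in fx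
  ... | true  = ⊥-elim (All.lookup x∉ y∈ (uniq (here refl) fx))
  ... | false = ⨁-single u f y∈ fy (λ x∈ → uniq (there x∈))

⨁-xor : ∀ {A : Set} (xs : List A) f g → ⨁ xs (λ x → f x xor g x) ≡ ⨁ xs f xor ⨁ xs g
⨁-xor []       f g = refl
⨁-xor (x ∷ xs) f g = trans (cong ((f x xor g x) xor_) (⨁-xor xs f g)) (xor-interchange (f x) (g x) (⨁ xs f) (⨁ xs g))

module _ {A B : Set} where

  ⨁-swap : ∀ (xs : List A) (ys : List B) (f : A → B → Bool) →
           ⨁ xs (λ x → ⨁ ys (f x)) ≡ ⨁ ys (λ y → ⨁ xs (λ x → f x y))
  ⨁-swap []       ys f = sym (⨁-false ys (λ _ → refl))
  ⨁-swap (x ∷ xs) ys f = begin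
    ⨁ ys (f x) xor ⨁ xs (λ x → ⨁ ys (f x))               ≡⟨ cong (⨁ ys (f x) xor_) (⨁-swap xs ys f) ⟩
    ⨁ ys (f x) xor ⨁ ys (λ y → ⨁ xs (λ x → f x y))        ≡⟨ ⨁-xor ys (f x) (λ y → ⨁ xs (λ x → f x y)) ⟨
    ⨁ ys (λ y → f x y xor ⨁ xs (λ x → f x y))             ∎
    where
    open ≡-Reasoning

  ⨁-map : ∀ (g : A → B) xs f → ⨁ (map g xs) f ≡ ⨁ xs (λ x → f (g x))
  ⨁-map g []       f = refl
  ⨁-map g (x ∷ xs) f = cong (f (g x) xor_) (⨁-map g xs f)

⨁-× : ∀ {A B : Set} (xs : List A) (ys : List B) f →
      ⨁ (cartesianProduct xs ys) f ≡ ⨁ xs (λ x → ⨁ ys (λ y → f (x , y)))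
⨁-× []       ys f = refl
⨁-× (x ∷ xs) ys f = trans (⨁-++ (map (x ,_) ys) _ f)
  (cong₂ _xor_ (⨁-map (x ,_) ys f) (⨁-× xs ys f))

odd#-filter : ∀ {A : Set} {P : A → Set} (P? : ∀ x → Dec (P x)) xs → odd# (filter P? xs) ≡ ⨁ xs (λ x → does (P? x))
odd#-filter P? []       = refl
odd#-filter P? (x ∷ xs) with does (P? x)
... | true  = cong (true xor_) (odd#-filter P? xs)
... | false = odd#-filter P? xs

-- Off the diagonal, the entries of a symmetric matrix cancel in pairs.
⨁-symmetric : ∀ {A : Set} (f : A → A → Bool) → (∀ x y → f x y ≡ f y x) → ∀ xs →
              ⨁ xs (λ x → ⨁ xs (f x)) ≡ ⨁ xs (λ x → f x x)
⨁-symmetric f f-sym []       = refl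
⨁-symmetric f f-sym (x ∷ xs) = begin
  (f x x xor row) xor ⨁ xs (λ y → f y x xor ⨁ xs (f y))      ≡⟨ cong ((f x x xor row) xor_) (⨁-xor xs _ _) ⟩
  (f x x xor row) xor (⨁ xs (λ y → f y x) xor rest)          ≡⟨ cong (λ a → (f x x xor row) xor (a xor rest)) (⨁-cong xs (λ {y} _ → f-sym y x)) ⟩
  (f x x xor row) xor (row xor rest)                          ≡⟨ xor-assoc (f x x) row _ ⟩
  f x x xor (row xor (row xor rest))                          ≡⟨ cong (f x x xor_) (xor-assoc row row rest) ⟨
  f x x xor ((row xor row) xor rest)                          ≡⟨ cong (λ a → f x x xor (a xor rest)) (xor-same row) ⟩
  f x x xor rest                                              ≡⟨ cong (f x x xor_) (⨁-symmetric f f-sym xs) ⟩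
  f x x xor ⨁ xs (λ y → f y y)                               ∎
  where
  open ≡-Reasoning
  row rest : Bool
  row  = ⨁ xs (f x)
  rest = ⨁ xs (λ y → ⨁ xs (f y))

does-true : ∀ {P : Set} (d : Dec P) → does d ≡ true → P
does-true (yes p) _ = p

true-does : ∀ {P : Set} (d : Dec P) → P → does d ≡ true
true-does (yes _) _ = refl
true-does (no ¬p) p = ⊥-elim (¬p p)

does-cong : ∀ {P Q : Set} (d : Dec P) (e : Dec Q) → (P → Q) → (Q → P) → does d ≡ does e
does-cong (yes _) (yes _) _ _ = refl
does-cong (no _)  (no _)  _ _ = refl
does-cong (yes p) (no ¬q) f _ = ⊥-elim (¬q (f p))
does-cong (no ¬p) (yes q) _ g = ⊥-elim (¬p (g q))

-- Finite sets

record Enumeration {A : Set} (P : A → Set) : Set where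
  field
    list     : List A
    unique   : Unique list
    sound    : ∀ {x} → x ∈ list → P x
    complete : ∀ {x} → P x → x ∈ list

open Enumeration

parity : ∀ {A : Set} {P : A → Set} → Enumeration P → Bool
parity E = odd# (list E)

module _ {A B : Set} {P : A → Set} {Q : B → Set} (E : Enumeration P) (F : Enumeration Q)
         {R : A → B → Set} (R? : ∀ x y → Dec (R x y)) where

  -- In the Boolean matrix of `R` every row has exactly one true entry, so each element of `E` can
  -- be replaced by the sum of its row.
  parity-rows : (∀ {x} → P x → ∃[ y ] (Q y × R x y)) →
                (∀ {x y y′} → P x → Q y → Q y′ → R x y → R x y′ → y ≡ y′) →
                parity E ≡ ⨁ (list E) (λ x → ⨁ (list F) (λ y → does (R? x y)))
  parity-rows total functional = ⨁-cong (list E) row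
    where
    row : ∀ {x} → x ∈ list E → true ≡ ⨁ (list F) (λ y → does (R? x y))
    row {x} x∈ with total (sound E x∈)
    ... | y , q , r = sym (⨁-single (unique F) _ (complete F q) (true-does (R? x y) r)
                        (λ {z} z∈ t → functional (sound E x∈) (sound F z∈) q (does-true (R? x z) t) r))

-- Double counting of the matrix of `R` by rows and by columns. A relation that is total and
-- single-valued in both directions stands in for a bijection, so no inverse function has to be
-- constructed.
parity-bijection : ∀ {A B : Set} {P : A → Set} {Q : B → Set} (E : Enumeration P) (F : Enumeration Q)
                   {R : A → B → Set} (R? : ∀ x y → Dec (R x y)) →
                   (∀ {x} → P x → ∃[ y ] (Q y × R x y)) →
                   (∀ {x y y′} → P x → Q y → Q y′ → R x y → R x y′ → y ≡ y′) →
                   (∀ {y} → Q y → ∃[ x ] (P x × R x y)) →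
                   (∀ {x x′ y} → P x → P x′ → Q y → R x y → R x′ y → x ≡ x′) →
                   parity E ≡ parity F
parity-bijection E F R? total functional surjective injective =
  trans (parity-rows E F R? total functional)
    (trans (⨁-swap (list E) (list F) _)
      (sym (parity-rows F E (λ y x → R? x y) surjective (λ q p p′ → injective p p′ q))))

restrict : ∀ {A : Set} {P Q : A → Set} → Enumeration P → (∀ x → Dec (Q x)) → Enumeration (λ x → P x × Q x)
restrict E Q? = record
  { list     = filter Q? (list E)
  ; unique   = filter⁺ Q? (unique E)
  ; sound    = λ x∈ → let x∈E , q = ∈-filter⁻ Q? x∈ in sound E x∈E , q
  ; complete = λ (p , q) → ∈-filter⁺ Q? (complete E p) q
  }

-- The matrix of `R` is symmetric, so modulo 2 its entries cancel off the diagonal and the fixed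
-- points remain.
parity-involution : ∀ {A : Set} {P : A → Set} (E : Enumeration P) {R : A → A → Set} (R? : ∀ x y → Dec (R x y)) →
                    (∀ {x y} → R x y → R y x) →
                    (∀ {x} → P x → ∃[ y ] (P y × R x y)) →
                    (∀ {x y y′} → P x → P y → P y′ → R x y → R x y′ → y ≡ y′) →
                    parity E ≡ parity (restrict E (λ x → R? x x))
parity-involution E R? R-sym total functional =
  trans (parity-rows E E R? total functional)
    (trans (⨁-symmetric _ (λ x y → does-cong (R? x y) (R? y x) R-sym R-sym) (list E))
      (sym (odd#-filter (λ x → R? x x) (list E))))

enumeration-⇔ : ∀ {A : Set} {P Q : A → Set} → Enumeration P → (∀ {x} → P x → Q x) → (∀ {x} → Q x → P x) → Enumeration Q
enumeration-⇔ E to from = record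
  { list = list E ; unique = unique E ; sound = λ x∈ → to (sound E x∈) ; complete = λ q → complete E (from q) }

below : ∀ b → Enumeration (_< b)
below b = record { list = upTo b ; unique = upTo⁺ b ; sound = ∈-upTo⁻ ; complete = ∈-upTo⁺ }

_⊗_ : ∀ {A B : Set} {P : A → Set} {Q : B → Set} → Enumeration P → Enumeration Q →
      Enumeration (λ z → P (proj₁ z) × Q (proj₂ z))
E ⊗ F = record
  { list     = cartesianProduct (list E) (list F)
  ; unique   = cartesianProduct⁺ (unique E) (unique F)
  ; sound    = λ z∈ → let x∈ , y∈ = ∈-cartesianProduct⁻ (list E) (list F) z∈ in sound E x∈ , sound F y∈
  ; complete = λ (p , q) → ∈-cartesianProduct⁺ (complete E p) (complete F q)
  }

parity-⊗ : ∀ {A B : Set} {P : A → Set} {Q : B → Set} (E : Enumeration P) (F : Enumeration Q) →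
           parity (E ⊗ F) ≡ parity E ∧ parity F
parity-⊗ E F = begin
  odd# (cartesianProduct (list E) (list F))           ≡⟨ ⨁-× (list E) (list F) (λ _ → true) ⟩
  ⨁ (list E) (λ _ → parity F)                        ≡⟨ ⨁-cong (list E) (λ _ → sym (∧-identityʳ (parity F))) ⟩
  ⨁ (list E) (λ _ → parity F ∧ true)                 ≡⟨ ⨁-∧ (parity F) (list E) (λ _ → true) ⟩
  parity F ∧ parity E                                 ≡⟨ ∧-comm (parity F) (parity E) ⟩
  parity E ∧ parity F                                 ∎
  where open ≡-Reasoning

-- Enumeration of the solutions, and the exchange of y and z

open NaturalSolutions

isSolution? : ∀ n t → Dec (IsSolution n t)
isSolution? n (x , y , z) = map′ (λ (px , py , pz , eq) → isSolution px py pz eq) (λ (isSolution px py pz eq) → px , py , pz , eq)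
  ((0 <? x) ×-dec (0 <? y) ×-dec (0 <? z) ×-dec (3 * (x * x) + 4 * (y * z) ≟ 24 * n + 7))

m≤k*[m*o] : ∀ k {m o} → 0 < k → 0 < o → m ≤ k * (m * o)
m≤k*[m*o] k {m} {o} k>0 o>0 = ≤-trans (m≤m*n m o {{>-nonZero o>0}}) (m≤n*m (m * o) k {{>-nonZero k>0}})

-- Each coordinate is at most N because the others are positive; the bound is N + 1 because `below`
-- is strict.
solution-bounded : ∀ {n x y z} → IsSolution n (x , y , z) → x < 24 * n + 8 × y < 24 * n + 8 × z < 24 * n + 8
solution-bounded {n} {x} {y} {z} (isSolution px py pz eq) =
  bound (≤-trans (m≤k*[m*o] 3 (s≤s z≤n) px) (m≤m+n _ _)) ,
  bound (≤-trans (m≤k*[m*o] 4 (s≤s z≤n) pz) (m≤n+m (4 * (y * z)) (3 * (x * x)))) ,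
  bound (≤-trans (subst (z ≤_) (cong (4 *_) (*-comm z y)) (m≤k*[m*o] 4 (s≤s z≤n) py)) (m≤n+m (4 * (y * z)) (3 * (x * x))))
  where
  bound : ∀ {m} → m ≤ 3 * (x * x) + 4 * (y * z) → m < 24 * n + 8
  bound le = ≤-trans (s≤s (≤-trans le (≤-reflexive eq))) (≤-reflexive (solve n))
    where
    solve : ∀ n → suc (24 * n + 7) ≡ 24 * n + 8
    solve = solve-∀

solutions : ∀ n → Enumeration (IsSolution n)
solutions n = enumeration-⇔ (restrict (below b ⊗ (below b ⊗ below b)) (isSolution? n)) proj₂ (λ sol → solution-bounded sol , sol)
  where
  b : ℕ
  b = 24 * n + 8

IsRepresentation : ℕ → ℕ × ℕ → Set
IsRepresentation n (x , y) = 0 < x × 0 < y × 3 * (x * x) + 4 * (y * y) ≡ 24 * n + 7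

Swapped : ℕ × ℕ × ℕ → ℕ × ℕ × ℕ → Set
Swapped (x , y , z) (x′ , y′ , z′) = x ≡ x′ × y ≡ z′ × z ≡ y′

swapped? : ∀ t t′ → Dec (Swapped t t′)
swapped? (x , y , z) (x′ , y′ , z′) = (x ≟ x′) ×-dec (y ≟ z′) ×-dec (z ≟ y′)

swap-solution : ∀ {n x y z} → IsSolution n (x , y , z) → IsSolution n (x , z , y)
swap-solution {n} {x} {y} {z} (isSolution px py pz eq) =
  isSolution px pz py (trans (cong (λ t → 3 * (x * x) + 4 * t) (*-comm z y)) eq)

Spread : ℕ × ℕ × ℕ → ℕ × ℕ → Set
Spread (x , y , z) (x′ , y′) = x ≡ x′ × y ≡ y′

representations-parity : ∀ n (E : Enumeration (IsRepresentation n)) → parity (solutions n) ≡ parity E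
representations-parity n E = trans
  (parity-involution (solutions n) swapped? (λ (a , b , c) → sym a , sym c , sym b)
    (λ {(x , y , z)} sol → (x , z , y) , swap-solution sol , refl , refl , refl)
    (λ { _ _ _ (refl , refl , refl) (refl , refl , refl) → refl }))
  (parity-bijection (restrict (solutions n) (λ t → swapped? t t)) E {Spread} (λ (x , y , z) (x′ , y′) → (x ≟ x′) ×-dec (y ≟ y′))
    (λ { {x , y , z} (isSolution px py pz eq , _ , refl , _) → (x , y) , (px , py , eq) , refl , refl })
    (λ { _ _ _ (refl , refl) (refl , refl) → refl })
    (λ { {x , y} (px , py , eq) → (x , y , y) , (isSolution px py py eq , refl , refl , refl) , refl , refl })
    (λ { (_ , _ , refl , _) (_ , _ , refl , _) _ (refl , refl) (refl , refl) → refl }))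

diagonal-parity : ∀ n → parity (solutions n) ≡ parity (restrict (solutions n) (λ t → partner? t t))
diagonal-parity n = parity-involution (solutions n) partner? (λ {t} {t′} → partner-sym {t} {t′})
  partner-exists (λ {t} _ sol′ sol″ → partner-unique {n} {t} sol′ sol″)

-- Fixed points of the hexagon involution as divisors below the square root

open NaturalSolutions

SmallDivisor : ℕ → ℕ → Set
SmallDivisor N d = d ∣ N × d * d < N

<⇒+ : ∀ {m n} → m < n → ∃[ k ] (0 < k × n ≡ m + k)
<⇒+ {zero}  {n}     p       = n , p , refl
<⇒+ {suc m} {suc n} (s≤s p) with <⇒+ p
... | k , k>0 , refl = k , k>0 , refl

-- d and e lie in different odd classes modulo 4.
de≡3⇒4∣d+e : ∀ d e → (d * e) % 4 ≡ 3 → 4 ∣ d + e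
de≡3⇒4∣d+e d e p = m%n≡0⇒n∣m (d + e) 4 (trans (%-distribˡ-+ d e 4)
  (residues (d % 4) (e % 4) (m%n<n d 4) (m%n<n e 4) (trans (sym (%-distribˡ-* d e 4)) p)))
  where
  residues : ∀ a b → a < 4 → b < 4 → (a * b) % 4 ≡ 3 → (a + b) % 4 ≡ 0
  residues 1 3 _ _ _ = refl
  residues 3 1 _ _ _ = refl
  residues 0 b _ _ ()
  residues 1 0 _ _ ()
  residues 1 1 _ _ ()
  residues 1 2 _ _ ()
  residues 2 0 _ _ ()
  residues 2 1 _ _ ()
  residues 2 2 _ _ ()
  residues 2 3 _ _ ()
  residues 3 0 _ _ ()
  residues 3 2 _ _ ()
  residues 3 3 _ _ ()
  residues _ (suc (suc (suc (suc _)))) _ (s≤s (s≤s (s≤s (s≤s ())))) _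
  residues (suc (suc (suc (suc _)))) _ (s≤s (s≤s (s≤s (s≤s ())))) _ _

24n+7%4≡3 : ∀ n → (24 * n + 7) % 4 ≡ 3
24n+7%4≡3 n = trans (cong (_% 4) (eq n)) ([m+kn]%n≡m%n 7 (6 * n) 4)
  where
  eq : ∀ n → 24 * n + 7 ≡ 7 + 6 * n * 4
  eq = solve-∀

3∤24n+7 : ∀ n → ¬ 3 ∣ 24 * n + 7
3∤24n+7 n p = from-no (3 ∣? 7) (∣m+n∣m⇒∣n p (∣-trans (divides 8 refl) (m∣m*n n)))

-- x = y gives 24n+7 = x(3x + 4z); y = 2x + z gives 24n+7 = (x + 2z)(3x + 2z).
Factored : ℕ × ℕ × ℕ → ℕ → ℕ → Set
Factored (x , y , z) d e = (x ≡ y × d ≡ x × e ≡ 3 * x + 4 * z) ⊎ (y ≡ 2 * x + z × d ≡ x + 2 * z × e ≡ 3 * x + 2 * z)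

factored-product : ∀ {n t d e} → IsSolution n t → Factored t d e → d * e ≡ 24 * n + 7
factored-product {t = x , y , z} sol (inj₁ (refl , refl , refl)) = trans (eq x z) (IsSolution.equation sol)
  where
  eq : ∀ x z → x * (3 * x + 4 * z) ≡ 3 * (x * x) + 4 * (x * z)
  eq = solve-∀
factored-product {t = x , y , z} sol (inj₂ (refl , refl , refl)) = trans (eq x z) (IsSolution.equation sol)
  where
  eq : ∀ x z → (x + 2 * z) * (3 * x + 2 * z) ≡ 3 * (x * x) + 4 * ((2 * x + z) * z)
  eq = solve-∀

factored-d<e : ∀ {n t d e} → IsSolution n t → Factored t d e → d < e
factored-d<e {t = x , y , z} (isSolution px _ _ _) (inj₁ (refl , refl , refl)) =
  subst (x <_) (eq x z) (m<m+n x (≤-trans px (≤-trans (m≤m+n x _) (m≤m+n _ (4 * z)))))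
  where
  eq : ∀ x z → x + (x + x + 4 * z) ≡ 3 * x + 4 * z
  eq = solve-∀
factored-d<e {t = x , y , z} (isSolution px _ _ _) (inj₂ (refl , refl , refl)) =
  subst (x + 2 * z <_) (eq x z) (m<m+n (x + 2 * z) (≤-trans px (m≤m+n x x)))
  where
  eq : ∀ x z → x + 2 * z + (x + x) ≡ 3 * x + 2 * z
  eq = solve-∀

factored-d>0 : ∀ {n t d e} → IsSolution n t → Factored t d e → 0 < d
factored-d>0 (isSolution px _ _ _) (inj₁ (_ , refl , _)) = px
factored-d>0 (isSolution px _ _ _) (inj₂ (_ , refl , _)) = ≤-trans px (m≤m+n _ _)

square<product : ∀ {d e} → 0 < d → d < e → d * d < d * e
square<product {suc d} _ p = *-monoʳ-< (suc d) p

-- Solutions with x = y have e > 3d and those with y = 2x + z have e < 3d; this keeps a divisor from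
-- arising in both ways.
3[x+2z]+4w≢3x+2z : ∀ x z w → 0 < w → ¬ 3 * (x + 2 * z) + 4 * w ≡ 3 * x + 2 * z
3[x+2z]+4w≢3x+2z x z (suc w) _ eq =
  <-irrefl (sym eq) (subst (3 * x + 2 * z <_) (split x z w) (m<m+n (3 * x + 2 * z) {4 * z + 4 * suc w} (≤-trans (s≤s z≤n) (m≤n+m _ (4 * z)))))
  where
  split : ∀ x z w → 3 * x + 2 * z + (4 * z + 4 * suc w) ≡ 3 * (x + 2 * z) + 4 * suc w
  split = solve-∀

factors-unique : ∀ {n t t′ d e} → IsSolution n t → IsSolution n t′ → Factored t d e → Factored t′ d e → t ≡ t′
factors-unique {t = x , _ , z} {x , _ , z′} _ _ (inj₁ (refl , refl , refl)) (inj₁ (refl , refl , eq)) =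
  cong (λ z → x , x , z) (*-cancelˡ-≡ z z′ 4 (+-cancelˡ-≡ (3 * x) _ _ eq))
factors-unique {t = x , _ , z} {x′ , _ , z′} _ _ (inj₂ (refl , refl , refl)) (inj₂ (refl , d≡ , e≡)) =
  cong₂ (λ x z → x , 2 * x + z , z) x≡x′ z≡z′
  where
  split : ∀ x z → 3 * x + 2 * z ≡ 2 * x + (x + 2 * z)
  split = solve-∀
  x≡x′ : x ≡ x′
  x≡x′ = *-cancelˡ-≡ x x′ 2 (+-cancelʳ-≡ (x + 2 * z) _ _
    (trans (sym (split x z)) (trans e≡ (trans (split x′ z′) (cong (2 * x′ +_) (sym d≡))))))
  z≡z′ : z ≡ z′
  z≡z′ = *-cancelˡ-≡ z z′ 2 (+-cancelˡ-≡ x′ _ _ (trans (cong (_+ 2 * z) (sym x≡x′)) d≡))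
factors-unique {t = x , _ , z} {x′ , _ , z′} (isSolution _ _ pz _) _ (inj₁ (refl , refl , refl)) (inj₂ (refl , refl , eq)) =
  ⊥-elim (3[x+2z]+4w≢3x+2z x′ z′ z pz eq)
factors-unique {t = x , _ , z} {x′ , _ , z′} _ (isSolution _ _ pz′ _) (inj₂ (refl , refl , eq)) (inj₁ (refl , refl , eq′)) =
  ⊥-elim (3[x+2z]+4w≢3x+2z x z z′ pz′ (trans (sym eq′) eq))

product>0 : ∀ {n d e} → d * e ≡ 24 * n + 7 → 0 < d
product>0 {n} {zero}  p = ⊥-elim (0≢1+n (trans p (+-comm (24 * n) 7)))
product>0 {n} {suc d} _ = s≤s z≤n

-- Let w = (d + e)/4, an integer because N is 3 modulo 4. If d < w, then e > 3d, and x = y = d, z =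
-- w - d works. If d > w, then z = d - w and x = w - z work, where z < w is equivalent to d < e. The
-- case d = w means e = 3d, which would make 3 divide N.
factors-exist : ∀ n d e → d * e ≡ 24 * n + 7 → d < e → ∃[ t ] (IsSolution n t × OnDiagonal t × Factored t d e)
factors-exist n d e de≡ d<e = from-quarter (de≡3⇒4∣d+e d e (trans (cong (_% 4) de≡) (24n+7%4≡3 n)))
  where
  Goal : Set
  Goal = ∃[ t ] (IsSolution n t × OnDiagonal t × Factored t d e)

  e>3d : ∀ z → 0 < z → d + e ≡ (d + z) * 4 → Goal
  e>3d z z>0 d+e≡ = (d , d , z) , isSolution d>0 d>0 z>0 (trans (eq d z) (trans (cong (d *_) (sym e≡)) de≡)) , inj₁ refl , inj₁ (refl , refl , e≡)
    where
    split : ∀ d z → (d + z) * 4 ≡ d + (3 * d + 4 * z)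
    split = solve-∀
    e≡ : e ≡ 3 * d + 4 * z
    e≡ = +-cancelˡ-≡ d _ _ (trans d+e≡ (split d z))
    eq : ∀ x z → 3 * (x * x) + 4 * (x * z) ≡ x * (3 * x + 4 * z)
    eq = solve-∀
    d>0 : 0 < d
    d>0 = product>0 {n} {d} {e} de≡

  e≢3d : ¬ d + e ≡ d * 4
  e≢3d d+e≡ = 3∤24n+7 n (divides (d * d) (trans (sym de≡) (trans (cong (d *_) e≡3d) (eq d))))
    where
    eq : ∀ d → d * (d * 3) ≡ d * d * 3
    eq = solve-∀
    split : ∀ d → d * 4 ≡ d + d * 3
    split = solve-∀
    e≡3d : e ≡ d * 3
    e≡3d = +-cancelˡ-≡ d _ _ (trans d+e≡ (split d))

  e<3d : ∀ x z → 0 < x → 0 < z → d ≡ z + x + z → d + e ≡ (z + x) * 4 → Goal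
  e<3d x z x>0 z>0 d≡ d+e≡ =
    (x , 2 * x + z , z)
    , isSolution x>0 (≤-trans z>0 (m≤n+m z (2 * x))) z>0 (trans (eq x z) (trans (cong₂ _*_ (sym d≡) (sym e≡)) de≡))
    , inj₂ refl , inj₂ (refl , trans d≡ (shuffle x z) , e≡)
    where
    shuffle : ∀ x z → z + x + z ≡ x + 2 * z
    shuffle = solve-∀
    split : ∀ x z → (z + x) * 4 ≡ z + x + z + (3 * x + 2 * z)
    split = solve-∀
    e≡ : e ≡ 3 * x + 2 * z
    e≡ = +-cancelˡ-≡ (z + x + z) _ _ (trans (cong (_+ e) (sym d≡)) (trans d+e≡ (split x z)))
    eq : ∀ x z → 3 * (x * x) + 4 * ((2 * x + z) * z) ≡ (z + x + z) * (3 * x + 2 * z)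
    eq = solve-∀

  remainder<quarter : ∀ w z → d ≡ w + z → d + e ≡ w * 4 → z < w
  remainder<quarter w z d≡ d+e≡ = *-cancelˡ-< 2 z w (+-cancelˡ-< (2 * w) _ _
    (subst₂ _<_ (trans (cong₂ _+_ d≡ d≡) (dbl w z)) (trans d+e≡ (quad w)) (+-monoʳ-< d d<e)))
    where
    dbl : ∀ w z → (w + z) + (w + z) ≡ 2 * w + 2 * z
    dbl = solve-∀
    quad : ∀ w → w * 4 ≡ 2 * w + 2 * w
    quad = solve-∀

  from-quarter : 4 ∣ d + e → Goal
  from-quarter (divides w d+e≡) with <-cmp d w
  ... | tri≈ _ d≡w _ = ⊥-elim (e≢3d (trans d+e≡ (cong (_* 4) (sym d≡w))))
  ... | tri< d<w _ _ with <⇒+ d<w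
  ... | z , z>0 , w≡ = e>3d z z>0 (trans d+e≡ (cong (_* 4) w≡))
  from-quarter (divides w d+e≡) | tri> _ _ w<d with <⇒+ w<d
  ... | z , z>0 , d≡ with <⇒+ (remainder<quarter w z d≡ d+e≡)
  ... | x , x>0 , w≡ = e<3d x z x>0 z>0 (trans d≡ (cong (_+ z) w≡)) (trans d+e≡ (cong (_* 4) w≡))

diagonal-factored : ∀ {t} → OnDiagonal t → ∃[ d ] ∃[ e ] Factored t d e
diagonal-factored (inj₁ p) = _ , _ , inj₁ (p , refl , refl)
diagonal-factored (inj₂ p) = _ , _ , inj₂ (p , refl , refl)

-- Since d determines its cofactor, the relation between solutions and small divisors can leave `e`
-- out, which also makes it directly decidable.
FirstFactor : ℕ × ℕ × ℕ → ℕ → Set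
FirstFactor (x , y , z) d = (x ≡ y × d ≡ x) ⊎ (y ≡ 2 * x + z × d ≡ x + 2 * z)

firstFactor? : ∀ t d → Dec (FirstFactor t d)
firstFactor? (x , y , z) d = ((x ≟ y) ×-dec (d ≟ x)) ⊎-dec ((y ≟ 2 * x + z) ×-dec (d ≟ x + 2 * z))

factored⇒first : ∀ {t d e} → Factored t d e → FirstFactor t d
factored⇒first (inj₁ (p , q , _)) = inj₁ (p , q)
factored⇒first (inj₂ (p , q , _)) = inj₂ (p , q)

first⇒factored : ∀ {t d} → FirstFactor t d → ∃[ e ] Factored t d e
first⇒factored (inj₁ (p , q)) = _ , inj₁ (p , q , refl)
first⇒factored (inj₂ (p , q)) = _ , inj₂ (p , q , refl)

diagonals-disjoint : ∀ {n x y z} → IsSolution n (x , y , z) → x ≡ y → ¬ y ≡ 2 * x + z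
diagonals-disjoint {x = x} {z = z} (isSolution _ _ pz _) refl eq =
  <-irrefl eq (subst (x <_) (sym (split x z)) (m<m+n x (≤-trans pz (m≤n+m z x))))
  where
  split : ∀ x z → 2 * x + z ≡ x + (x + z)
  split = solve-∀

first-unique : ∀ {n t d d′} → IsSolution n t → FirstFactor t d → FirstFactor t d′ → d ≡ d′
first-unique _ (inj₁ (_ , refl)) (inj₁ (_ , refl)) = refl
first-unique _ (inj₂ (_ , refl)) (inj₂ (_ , refl)) = refl
first-unique sol (inj₁ (x≡y , _)) (inj₂ (eq , _)) = ⊥-elim (diagonals-disjoint sol x≡y eq)
first-unique sol (inj₂ (eq , _)) (inj₁ (x≡y , _)) = ⊥-elim (diagonals-disjoint sol x≡y eq)

cofactor-unique : ∀ {n d e e′} → d * e ≡ 24 * n + 7 → d * e′ ≡ 24 * n + 7 → e ≡ e′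
cofactor-unique {n} {zero} p _ = ⊥-elim (0≢1+n (trans p (+-comm (24 * n) 7)))
cofactor-unique {n} {suc d} {e} {e′} p q = *-cancelˡ-≡ e e′ (suc d) (trans p (sym q))

smallDivisors-parity : ∀ n (E : Enumeration (SmallDivisor (24 * n + 7))) → parity (solutions n) ≡ parity E
smallDivisors-parity n E = trans (diagonal-parity n)
  (parity-bijection (restrict (solutions n) (λ t → partner? t t)) E firstFactor?
    (λ (sol , p) → total sol (partner-self⇒ sol p))
    (λ (sol , _) _ _ → first-unique sol)
    surjective
    (λ (sol , _) (sol′ , _) _ → injective sol sol′))
  where
  small : ∀ {t d e} → IsSolution n t → Factored t d e → SmallDivisor (24 * n + 7) d
  small {d = d} {e} sol f = divides e (trans (sym (factored-product sol f)) (*-comm d e)) ,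
    subst (d * d <_) (factored-product sol f) (square<product (factored-d>0 sol f) (factored-d<e sol f))

  total : ∀ {t} → IsSolution n t → OnDiagonal t → ∃[ d ] (SmallDivisor (24 * n + 7) d × FirstFactor t d)
  total sol p with diagonal-factored p
  ... | d , e , f = d , small sol f , factored⇒first f

  surjective : ∀ {d} → SmallDivisor (24 * n + 7) d → ∃[ t ] ((IsSolution n t × Partner t t) × FirstFactor t d)
  surjective {d} (divides e eq , d²<) =
    let t , sol , diag , f = factors-exist n d e (trans (*-comm d e) (sym eq))
                               (*-cancelˡ-< d d e (subst (d * d <_) (trans eq (*-comm e d)) d²<))
    in t , (sol , partner-self⇐ sol diag) , factored⇒first f

  injective : ∀ {t t′ d} → IsSolution n t → IsSolution n t′ → FirstFactor t d → FirstFactor t′ d → t ≡ t′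
  injective {t} {t′} {d} sol sol′ f f′ with first⇒factored f | first⇒factored f′
  ... | e , g | e′ , g′ = factors-unique sol sol′ g
    (subst (Factored t′ d) (cofactor-unique {n} {d} (factored-product sol′ g′) (factored-product sol g)) g′)

-- Small divisors of p^(2j+1) M

factor>0ˡ : ∀ {m n} → 0 < m * n → 0 < m
factor>0ˡ {suc m} _ = s≤s z≤n

factor>0ʳ : ∀ m {n} → 0 < m * n → 0 < n
factor>0ʳ m {n} p = factor>0ˡ {n} {m} (subst (0 <_) (*-comm m n) p)

strip : ∀ {p} → Prime p → ∀ d → 0 < d → ∃[ i ] ∃[ e ] (d ≡ p ^ i * e × ¬ p ∣ e)
strip {p} pr = <-rec _ step
  where
  p>1 : 1 < p
  p>1 = nonTrivial⇒n>1 p {{prime⇒nonTrivial pr}}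
  step : ∀ d → (∀ {d′} → d′ < d → 0 < d′ → ∃[ i ] ∃[ e ] (d′ ≡ p ^ i * e × ¬ p ∣ e)) →
         0 < d → ∃[ i ] ∃[ e ] (d ≡ p ^ i * e × ¬ p ∣ e)
  step d rec d>0 with p ∣? d
  ... | no p∤d = 0 , d , sym (*-identityˡ d) , p∤d
  ... | yes (divides q refl) with rec (m<m*n q p {{>-nonZero (factor>0ˡ d>0)}} p>1) (factor>0ˡ d>0)
  ... | i , e , q≡ , p∤e = suc i , e , trans (*-comm q p) (trans (cong (p *_) q≡) (sym (*-assoc p (p ^ i) e))) , p∤e

strip-unique : ∀ {p} → Prime p → ∀ i k {e f} → ¬ p ∣ e → ¬ p ∣ f → p ^ i * e ≡ p ^ k * f → i ≡ k × e ≡ f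
strip-unique pr zero zero {e} {f} _ _ eq = refl , trans (sym (*-identityˡ e)) (trans eq (*-identityˡ f))
strip-unique {p} pr zero (suc k) {e} {f} p∤e _ eq =
  ⊥-elim (p∤e (subst (p ∣_) (trans (sym (*-assoc p (p ^ k) f)) (trans (sym eq) (*-identityˡ e))) (m∣m*n (p ^ k * f))))
strip-unique {p} pr (suc i) zero {e} {f} _ p∤f eq =
  ⊥-elim (p∤f (subst (p ∣_) (trans (sym (*-assoc p (p ^ i) e)) (trans eq (*-identityˡ f))) (m∣m*n (p ^ i * e))))
strip-unique {p} pr (suc i) (suc k) {e} {f} p∤e p∤f eq =
  let i≡k , e≡f = strip-unique pr i k p∤e p∤f (*-cancelˡ-≡ _ _ p {{prime⇒nonZero pr}}
                    (trans (sym (*-assoc p (p ^ i) e)) (trans eq (*-assoc p (p ^ k) f))))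
  in cong suc i≡k , e≡f

prime∤product : ∀ {p m n} → Prime p → ¬ p ∣ m → ¬ p ∣ n → ¬ p ∣ m * n
prime∤product {p} {m} {n} pr p∤m p∤n p∣mn = [ p∤m , p∤n ]′ (euclidsLemma m n pr p∣mn)

[pⁱe][pᵏf] : ∀ p i k e f → (p ^ i * e) * (p ^ k * f) ≡ p ^ (i + k) * (e * f)
[pⁱe][pᵏf] p i k e f = trans (shuffle (p ^ i) e (p ^ k) f) (cong (_* (e * f)) (sym (^-distribˡ-+-* p i k)))
  where
  shuffle : ∀ a e b f → (a * e) * (b * f) ≡ (a * b) * (e * f)
  shuffle = solve-∀

IsDivisor : ℕ → ℕ → Set
IsDivisor M e = e ∣ M

divisors : ∀ M → 0 < M → Enumeration (IsDivisor M)
divisors M M>0 = enumeration-⇔ (restrict (below (suc M)) (λ e → e ∣? M)) proj₂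
  (λ {e} e∣M → s≤s (∣⇒≤ {{>-nonZero M>0}} e∣M) , e∣M)

module _ {p j M N : ℕ} (pr : Prime p) (p∤M : ¬ p ∣ M) (M>0 : 0 < M) (N≡ : N ≡ p ^ (2 * j + 1) * M) where

  private
    N>0 : 0 < N
    N>0 = subst (0 <_) (sym N≡) (>-nonZero⁻¹ _ {{m*n≢0 (p ^ (2 * j + 1)) M {{>-nonZero (m^n>0 p {{prime⇒nonZero pr}} (2 * j + 1))}} {{>-nonZero M>0}}}})

    p∤divisor : ∀ {e} → e ∣ M → ¬ p ∣ e
    p∤divisor e∣M p∣e = p∤M (∣-trans p∣e e∣M)

    halves : ∀ {i k} → i + k ≡ 2 * j + 1 → ¬ i ≤ j → k < suc j
    halves {i} {k} eq i≰j = s≤s (+-cancelˡ-≤ (suc j) k j (≤-trans (+-monoˡ-≤ k (≰⇒> i≰j)) (≤-reflexive (trans eq (odd j)))))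
      where
      odd : ∀ j → 2 * j + 1 ≡ suc j + j
      odd = solve-∀

    too-small : ∀ {i k} → i < suc j → k < suc j → ¬ i + k ≡ 2 * j + 1
    too-small {i} {k} (s≤s i≤j) (s≤s k≤j) eq = <-irrefl eq (subst (i + k <_) (sym (odd j)) (s≤s (+-mono-≤ i≤j k≤j)))
      where
      odd : ∀ j → 2 * j + 1 ≡ suc (j + j)
      odd = solve-∀

    -- One of d and N / d is p^i e with i ≤ j.
    LowPart : ℕ → ℕ × ℕ → Set
    LowPart d (i , e) = d ≡ p ^ i * e ⊎ d * (p ^ i * e) ≡ N

    lowPart? : ∀ d z → Dec (LowPart d z)
    lowPart? d (i , e) = (d ≟ p ^ i * e) ⊎-dec (d * (p ^ i * e) ≟ N)

    Index : ℕ × ℕ → Set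
    Index z = proj₁ z < suc j × IsDivisor M (proj₂ z)

    product-parts : ∀ {i k e f} → ¬ p ∣ e → ¬ p ∣ f → (p ^ i * e) * (p ^ k * f) ≡ N → i + k ≡ 2 * j + 1 × e * f ≡ M
    product-parts {i} {k} {e} {f} p∤e p∤f eq = strip-unique pr (i + k) (2 * j + 1) (prime∤product pr p∤e p∤f) p∤M
      (trans (sym ([pⁱe][pᵏf] p i k e f)) (trans eq N≡))

    total : ∀ {d} → SmallDivisor N d → ∃[ z ] (Index z × LowPart d z)
    total {d} (divides d′ eq , _) with strip pr d (factor>0ʳ d′ (subst (0 <_) eq N>0)) | strip pr d′ (factor>0ˡ (subst (0 <_) eq N>0))
    ... | i , e , d≡ , p∤e | k , f , d′≡ , p∤f with product-parts {i} {k} p∤e p∤f (trans (cong₂ _*_ (sym d≡) (sym d′≡)) (trans (*-comm d d′) (sym eq)))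
    ... | i+k≡ , ef≡ with i ≤? j
    ... | yes i≤j = (i , e) , (s≤s i≤j , divides f (trans (sym ef≡) (*-comm e f))) , inj₁ d≡
    ... | no i≰j  = (k , f) , (halves {i} i+k≡ i≰j , divides e (sym ef≡)) ,
                    inj₂ (trans (cong (d *_) (sym d′≡)) (trans (*-comm d d′) (sym eq)))

    functional : ∀ {d z z′} → SmallDivisor N d → Index z → Index z′ → LowPart d z → LowPart d z′ → z ≡ z′
    functional {d} {i , e} {k , f} (divides d′ eq , _) (i≤j , e∣M) (k≤j , f∣M) = cases
      where
      same : p ^ i * e ≡ p ^ k * f → (i , e) ≡ (k , f)
      same q = let i≡k , e≡f = strip-unique pr i k (p∤divisor e∣M) (p∤divisor f∣M) q in cong₂ _,_ i≡k e≡f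
      cases : LowPart d (i , e) → LowPart d (k , f) → (i , e) ≡ (k , f)
      cases (inj₁ refl) (inj₁ q) = same q
      cases (inj₂ q) (inj₂ q′) = same (*-cancelˡ-≡ _ _ d {{>-nonZero (factor>0ʳ d′ (subst (0 <_) eq N>0))}} (trans q (sym q′)))
      cases (inj₁ refl) (inj₂ q) = ⊥-elim (too-small i≤j k≤j (proj₁ (product-parts {i} {k} (p∤divisor e∣M) (p∤divisor f∣M) q)))
      cases (inj₂ q) (inj₁ refl) = ⊥-elim (too-small k≤j i≤j (proj₁ (product-parts {k} {i} (p∤divisor f∣M) (p∤divisor e∣M) q)))

    surjective : ∀ {z} → Index z → ∃[ d ] (SmallDivisor N d × LowPart d z)
    surjective {i , e} (i<1+j , divides f M≡) = by-size (<-cmp u v)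
      where
      k u v : ℕ
      k = 2 * j + 1 ∸ i
      u = p ^ i * e
      v = p ^ k * f
      i+k≡ : i + k ≡ 2 * j + 1
      i+k≡ = m+[n∸m]≡n (≤-trans (s≤s⁻¹ i<1+j) (≤-trans (m≤m+n j (j + 0)) (m≤m+n (2 * j) 1)))
      uv≡N : u * v ≡ N
      uv≡N = trans ([pⁱe][pᵏf] p i k e f) (trans (cong₂ (λ a b → p ^ a * b) i+k≡ (trans (*-comm e f) (sym M≡))) (sym N≡))
      u>0 : 0 < u
      u>0 = factor>0ˡ (subst (0 <_) (sym uv≡N) N>0)
      v>0 : 0 < v
      v>0 = factor>0ʳ u (subst (0 <_) (sym uv≡N) N>0)
      by-size : _ → ∃[ d ] (SmallDivisor N d × LowPart d (i , e))
      by-size (tri< u<v _ _) = u , (divides v (trans (sym uv≡N) (*-comm u v)) , subst (u * u <_) uv≡N (square<product u>0 u<v)) , inj₁ refl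
      by-size (tri> _ _ v<u) = v , (divides u (sym uv≡N) , subst (v * v <_) (trans (*-comm v u) uv≡N) (square<product v>0 v<u))
                                 , inj₂ (trans (*-comm v u) uv≡N)
      -- Equality would give i = k, so both exponents would be at most j although they add up to 2j
      -- + 1.
      by-size (tri≈ _ u≡v _) = ⊥-elim (too-small i<1+j (subst (_< suc j) i≡k i<1+j) i+k≡)
        where
        i≡k : i ≡ k
        i≡k = proj₁ (strip-unique pr i k (p∤divisor (divides f M≡)) (p∤divisor (divides e (trans M≡ (*-comm f e)))) u≡v)

    -- In the mixed cases d and d′ are complementary divisors, d d′ = N, and they cannot both lie
    -- below the square root of N.
    injective : ∀ {d d′ z} → SmallDivisor N d → SmallDivisor N d′ → Index z → LowPart d z → LowPart d′ z → d ≡ d′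
    injective _ _ _ (inj₁ refl) (inj₁ refl) = refl
    injective {d} {d′} {i , e} _ _ _ (inj₂ q) (inj₂ q′) =
      *-cancelʳ-≡ d d′ (p ^ i * e) {{>-nonZero (factor>0ʳ d (subst (0 <_) (sym q) N>0))}} (trans q (sym q′))
    injective {d} {d′} (_ , d²<) (_ , d′²<) _ (inj₁ refl) (inj₂ q) =
      ⊥-elim (<-asym (*-cancelˡ-< d′ d′ d (subst (d′ * d′ <_) (sym q) d′²<)) (*-cancelˡ-< d d d′ (subst (d * d <_) (trans (sym q) (*-comm d′ d)) d²<)))
    injective {d} {d′} (_ , d²<) (_ , d′²<) _ (inj₂ q) (inj₁ refl) =
      ⊥-elim (<-asym (*-cancelˡ-< d d d′ (subst (d * d <_) (sym q) d²<)) (*-cancelˡ-< d′ d′ d (subst (d′ * d′ <_) (trans (sym q) (*-comm d d′)) d′²<)))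

  smallDivisors-of-odd-power : (E : Enumeration (SmallDivisor N)) → parity E ≡ parity (below (suc j)) ∧ parity (divisors M M>0)
  smallDivisors-of-odd-power E = trans
    (parity-bijection E (below (suc j) ⊗ divisors M M>0) lowPart? total functional surjective injective)
    (parity-⊗ (below (suc j)) (divisors M M>0))

-- Parity of the divisor count, and the shape of N

open Enumeration

oddℕ : ℕ → Bool
oddℕ zero    = false
oddℕ (suc n) = not (oddℕ n)

odd#-length : ∀ {A : Set} (xs : List A) → odd# xs ≡ oddℕ (length xs)
odd#-length []       = refl
odd#-length (x ∷ xs) = cong not (odd#-length xs)

parity-below : ∀ b → parity (below b) ≡ oddℕ b
parity-below b = trans (odd#-length (upTo b)) (cong oddℕ (length-upTo b))

oddℕ-double : ∀ a → oddℕ (2 * a) ≡ false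
oddℕ-double zero    = refl
oddℕ-double (suc a) rewrite +-suc a (a + 0) = trans (not-involutive _) (oddℕ-double a)

oddℕ-suc-even : ∀ j → oddℕ (suc j) ≡ true → ∃[ a ] j ≡ 2 * a
oddℕ-suc-even zero          _ = 0 , refl
oddℕ-suc-even (suc (suc j)) p with oddℕ-suc-even j (trans (sym (not-involutive _)) p)
... | a , refl = suc a , sym (cong suc (+-suc a (a + 0)))

parity-inhabited : ∀ {A : Set} {P : A → Set} (E : Enumeration P) → parity E ≡ true → ∃[ x ] P x
parity-inhabited E odd with list E | sound E
... | x ∷ xs | sound = x , sound (here refl)

parity-singleton : ∀ {A : Set} {P : A → Set} (E : Enumeration P) {x} → P x → (∀ {y} → P y → y ≡ x) → parity E ≡ true
parity-singleton E p only = ⨁-single (unique E) (λ _ → true) (complete E p) refl (λ y∈ _ → only (sound E y∈))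

square-injective : ∀ {m n} → m * m ≡ n * n → m ≡ n
square-injective {m} {n} eq with <-cmp m n
... | tri< m<n _ _ = ⊥-elim (<-irrefl eq (*-mono-< m<n m<n))
... | tri≈ _ m≡n _ = m≡n
... | tri> _ _ n<m = ⊥-elim (<-irrefl (sym eq) (*-mono-< n<m n<m))

-- The involution e ↦ M/e, given as the relation e f = M, fixes exactly the square roots of M.
divisors-parity : ∀ {M} (M>0 : 0 < M) → parity (divisors M M>0) ≡ parity (restrict (divisors M M>0) (λ e → e * e ≟ M))
divisors-parity {M} M>0 = parity-involution (divisors M M>0) (λ e f → e * f ≟ M) (λ {e} {f} eq → trans (*-comm f e) eq)
  (λ { {e} (divides f M≡) → f , divides e (trans M≡ (*-comm f e)) , trans (*-comm e f) (sym M≡) })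
  (λ { {e} {f} {f′} (divides g M≡) _ _ eq eq′ →
       *-cancelˡ-≡ f f′ e {{>-nonZero (factor>0ʳ g (subst (0 <_) M≡ M>0))}} (trans eq (sym eq′)) })

divisors-odd⇒square : ∀ {M} (M>0 : 0 < M) → parity (divisors M M>0) ≡ true → ∃[ m ] m * m ≡ M
divisors-odd⇒square M>0 odd with parity-inhabited (restrict (divisors _ M>0) (λ e → e * e ≟ _)) (trans (sym (divisors-parity M>0)) odd)
... | m , _ , eq = m , eq

square⇒divisors-odd : ∀ m (M>0 : 0 < m * m) → parity (divisors (m * m) M>0) ≡ true
square⇒divisors-odd m M>0 = trans (divisors-parity M>0)
  (parity-singleton (restrict (divisors (m * m) M>0) (λ e → e * e ≟ m * m)) {m} (m∣m*n m , refl) (λ (_ , eq) → square-injective eq))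

OddPower : ℕ → Set
OddPower N = ∃[ p ] ∃[ j ] ∃[ M ] (Prime p × ¬ p ∣ M × N ≡ p ^ (2 * j + 1) * M)

prime-divisor : ∀ {N} → 1 < N → ∃[ p ] (Prime p × p ∣ N)
prime-divisor {N} N>1 with factorise N {{>-nonZero (<-trans (s≤s z≤n) N>1)}}
... | record { factors = [] ; isFactorisation = refl } = ⊥-elim (<-irrefl refl N>1)
... | record { factors = p ∷ ps ; isFactorisation = refl ; factorsPrime = pr ∷ _ } = p , pr , m∣m*n (product ps)

prime∣prime⇒≡ : ∀ {p q} → Prime p → Prime q → p ∣ q → p ≡ q
prime∣prime⇒≡ pr qr p∣q = [ (λ p≡1 → ⊥-elim (¬prime[1] (subst Prime p≡1 pr))) , (λ p≡q → p≡q) ]′ (prime⇒irreducible qr p∣q)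

-- Take a prime p dividing N. If it divides N exactly once, it is the required prime with j = 0.
-- Otherwise remove p²: this changes no exponent's parity, so either answer for N/p² extends to N,
-- and induction replaces a full factorisation.
square-or-oddPower : ∀ N → 0 < N → (∃[ m ] m * m ≡ N) ⊎ OddPower N
square-or-oddPower = <-rec _ step
  where
  extend : ∀ {p N} → Prime p → (∃[ m ] m * m ≡ N) ⊎ OddPower N → (∃[ m ] m * m ≡ N * p * p) ⊎ OddPower (N * p * p)
  extend {p} pr (inj₁ (m , refl)) = inj₁ (m * p , eq m p)
    where
    eq : ∀ m p → m * p * (m * p) ≡ m * m * p * p
    eq = solve-∀
  extend {p} pr (inj₂ (q , j , M , qr , q∤M , refl)) with p ≟ q
  ... | yes refl = inj₂ (p , suc j , M , pr , q∤M , trans (eq (p ^ (2 * j + 1)) p M) (cong (λ k → p ^ k * M) (exponent j)))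
    where
    eq : ∀ a p M → a * M * p * p ≡ p * (p * a) * M
    eq = solve-∀
    exponent : ∀ j → suc (suc (2 * j + 1)) ≡ 2 * suc j + 1
    exponent = solve-∀
  ... | no p≢q = inj₂ (q , j , M * p * p , qr , prime∤product qr (prime∤product qr q∤M q∤p) q∤p , eq (q ^ (2 * j + 1)) M p)
    where
    eq : ∀ a M p → a * M * p * p ≡ a * (M * p * p)
    eq = solve-∀
    q∤p : ¬ q ∣ p
    q∤p q∣p = p≢q (sym (prime∣prime⇒≡ qr pr q∣p))
  step : ∀ N → (∀ {N′} → N′ < N → 0 < N′ → (∃[ m ] m * m ≡ N′) ⊎ OddPower N′) → 0 < N → (∃[ m ] m * m ≡ N) ⊎ OddPower N
  step 1 _ _ = inj₁ (1 , refl)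
  step N@(suc (suc _)) rec N>0 with prime-divisor {N} (s≤s (s≤s z≤n))
  ... | p , pr , divides q N≡ with p ∣? q
  ... | no p∤q = inj₂ (p , 0 , q , pr , p∤q , trans N≡ (trans (*-comm q p) (cong (_* q) (sym (^-identityʳ p)))))
  ... | yes (divides r refl) = subst (λ N → (∃[ m ] m * m ≡ N) ⊎ OddPower N) (sym N≡) (extend pr (rec r<N r>0))
    where
    p>1 : 1 < p
    p>1 = nonTrivial⇒n>1 p {{prime⇒nonTrivial pr}}
    rp>0 : 0 < r * p
    rp>0 = factor>0ˡ (subst (0 <_) N≡ N>0)
    r>0 : 0 < r
    r>0 = factor>0ˡ rp>0
    r<N : r < N
    r<N = subst (r <_) (sym N≡) (<-trans (m<m*n r p {{>-nonZero r>0}} p>1) (m<m*n (r * p) p {{>-nonZero rp>0}} p>1))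

square%4≢3 : ∀ m → ¬ (m * m) % 4 ≡ 3
square%4≢3 m p = residues (m % 4) (m%n<n m 4) (trans (sym (%-distribˡ-* m m 4)) p)
  where
  residues : ∀ a → a < 4 → ¬ (a * a) % 4 ≡ 3
  residues 0 _ ()
  residues 1 _ ()
  residues 2 _ ()
  residues 3 _ ()
  residues (suc (suc (suc (suc _)))) (s≤s (s≤s (s≤s (s≤s ()))))

∧-true : ∀ {a b} → a ∧ b ≡ true → a ≡ true × b ≡ true
∧-true {true} {true} _ = refl , refl

smallDivisors-odd : ∀ n (E : Enumeration (SmallDivisor (24 * n + 7))) →
  parity E ≡ true ⇔ (∃[ p ] ∃[ m ] ∃[ a ] (Prime p × m ≥ 1 × ¬ p ∣ m × 24 * n + 7 ≡ p ^ (4 * a + 1) * m ^ 2))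
smallDivisors-odd n E = mk⇔ to from
  where
  N : ℕ
  N = 24 * n + 7
  N>0 : 0 < N
  N>0 = ≤-trans (s≤s z≤n) (m≤n+m 7 (24 * n))
  Target : Set
  Target = ∃[ p ] ∃[ m ] ∃[ a ] (Prime p × m ≥ 1 × ¬ p ∣ m × N ≡ p ^ (4 * a + 1) * m ^ 2)
  m²≡ : ∀ m → m * m ≡ m ^ 2
  m²≡ m = cong (m *_) (sym (*-identityʳ m))
  4a≡ : ∀ a → 2 * (2 * a) ≡ 4 * a
  4a≡ = solve-∀

  from-oddPower : OddPower N → parity E ≡ true → Target
  from-oddPower (p , j , M , pr , p∤M , N≡) odd =
    let even , square = ∧-true (trans (sym (smallDivisors-of-odd-power {p} {j} pr p∤M M>0 N≡ E)) odd)
        a , j≡ = oddℕ-suc-even j (trans (sym (parity-below (suc j))) even)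
        m , m²≡M = divisors-odd⇒square M>0 square
    in p , m , a , pr , factor>0ˡ (subst (0 <_) (sym m²≡M) M>0) , (λ p∣m → p∤M (∣-trans p∣m (subst (m ∣_) m²≡M (m∣m*n m))))
       , trans N≡ (cong₂ (λ k M → p ^ (k + 1) * M) (trans (cong (2 *_) j≡) (4a≡ a)) (trans (sym m²≡M) (m²≡ m)))
    where
    M>0 : 0 < M
    M>0 = factor>0ʳ (p ^ (2 * j + 1)) (subst (0 <_) N≡ N>0)

  to : parity E ≡ true → Target
  -- Squares are never 3 modulo 4, which rules out the first alternative.
  to odd = [ (λ (m , eq) → ⊥-elim (square%4≢3 m (trans (cong (_% 4) eq) (24n+7%4≡3 n)))) , (λ op → from-oddPower op odd) ]′
    (square-or-oddPower N N>0)

  from : Target → parity E ≡ true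
  from (p , m , a , pr , m≥1 , p∤m , N≡) = trans
    (smallDivisors-of-odd-power {p} {2 * a} pr (prime∤product pr p∤m p∤m) M>0
      (trans N≡ (cong₂ (λ k M → p ^ (k + 1) * M) (sym (4a≡ a)) (sym (m²≡ m)))) E)
    (cong₂ _∧_ (trans (parity-below (suc (2 * a))) (cong not (oddℕ-double a))) (square⇒divisors-odd m M>0))
    where
    M>0 : 0 < m * m
    M>0 = *-mono-< m≥1 m≥1

-- Power series over 𝔽₂

Series : Set
Series = ℕ → Bool

infix 4 _≐_ _≈[_]_
infixl 6 _⊕_

_≐_ : Series → Series → Set
X ≐ Y = ∀ m → X m ≡ Y m

-- Congruence modulo q^(n+1). It lets sufficiently long finite products and sums stand for the
-- infinite ones.
_≈[_]_ : Series → ℕ → Series → Set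
X ≈[ n ] Y = ∀ m → m ≤ n → X m ≡ Y m

_⊕_ : Series → Series → Series
(X ⊕ Y) m = X m xor Y m

one : Series
one zero    = true
one (suc m) = false

-- shift e X = q^e X
shift : ℕ → Series → Series
shift zero    X m       = X m
shift (suc e) X zero    = false
shift (suc e) X (suc m) = shift e X m

1+q^ : ℕ → Series → Series
1+q^ e X = X ⊕ shift e X

-- A product acts on a series factor by factor. The only multipliers that occur are monomials,
-- factors 1 + q^e and finite sums of monomials, so no Cauchy product is defined, and commutativity
-- becomes commutation of operators.
∏ : List ℕ → Series → Series
∏ es X = foldr 1+q^ X es

≐-sym : ∀ {X Y} → X ≐ Y → Y ≐ X
≐-sym p m = sym (p m)

≐-trans : ∀ {X Y Z} → X ≐ Y → Y ≐ Z → X ≐ Z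
≐-trans p q m = trans (p m) (q m)

≐⇒≈ : ∀ {n X Y} → X ≐ Y → X ≈[ n ] Y
≐⇒≈ p m _ = p m

≈-sym : ∀ {n X Y} → X ≈[ n ] Y → Y ≈[ n ] X
≈-sym p m m≤n = sym (p m m≤n)

≈-trans : ∀ {n X Y Z} → X ≈[ n ] Y → Y ≈[ n ] Z → X ≈[ n ] Z
≈-trans p q m m≤n = trans (p m m≤n) (q m m≤n)

⊕-cong : ∀ {X X′ Y Y′} → X ≐ X′ → Y ≐ Y′ → X ⊕ Y ≐ X′ ⊕ Y′
⊕-cong p q m = cong₂ _xor_ (p m) (q m)

⊕-cong-≈ : ∀ {n X X′ Y Y′} → X ≈[ n ] X′ → Y ≈[ n ] Y′ → X ⊕ Y ≈[ n ] X′ ⊕ Y′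
⊕-cong-≈ p q m m≤n = cong₂ _xor_ (p m m≤n) (q m m≤n)

⊕-interchange : ∀ X Y Z W → (X ⊕ Y) ⊕ (Z ⊕ W) ≐ (X ⊕ Z) ⊕ (Y ⊕ W)
⊕-interchange X Y Z W m = xor-interchange (X m) (Y m) (Z m) (W m)

shift-cong-≈ : ∀ e {n X Y} → X ≈[ n ] Y → shift e X ≈[ n ] shift e Y
shift-cong-≈ zero    p m       m≤n = p m m≤n
shift-cong-≈ (suc e) p zero    m≤n = refl
shift-cong-≈ (suc e) p (suc m) m≤n = shift-cong-≈ e p m (<⇒≤ m≤n)

shift-cong : ∀ e {X Y} → X ≐ Y → shift e X ≐ shift e Y
shift-cong e p m = shift-cong-≈ e {m} (≐⇒≈ p) m ≤-refl

shift-⊕ : ∀ e X Y → shift e (X ⊕ Y) ≐ shift e X ⊕ shift e Y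
shift-⊕ zero    X Y m       = refl
shift-⊕ (suc e) X Y zero    = refl
shift-⊕ (suc e) X Y (suc m) = shift-⊕ e X Y m

shift-shift : ∀ a b X → shift a (shift b X) ≐ shift (a + b) X
shift-shift zero    b X m       = refl
shift-shift (suc a) b X zero    = refl
shift-shift (suc a) b X (suc m) = shift-shift a b X m

shift-comm : ∀ a b X → shift a (shift b X) ≐ shift b (shift a X)
shift-comm a b X m = trans (shift-shift a b X m) (trans (cong (λ e → shift e X m) (+-comm a b)) (sym (shift-shift b a X m)))

shift-low : ∀ e X {m} → m < e → shift e X m ≡ false
shift-low (suc e) X {zero}  _       = refl
shift-low (suc e) X {suc m} (s≤s p) = shift-low e X p

1+q^-cong-≈ : ∀ e {n X Y} → X ≈[ n ] Y → 1+q^ e X ≈[ n ] 1+q^ e Y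
1+q^-cong-≈ e p = ⊕-cong-≈ p (shift-cong-≈ e p)

1+q^-cong : ∀ e {X Y} → X ≐ Y → 1+q^ e X ≐ 1+q^ e Y
1+q^-cong e p = ⊕-cong p (shift-cong e p)

1+q^-⊕ : ∀ e X Y → 1+q^ e (X ⊕ Y) ≐ 1+q^ e X ⊕ 1+q^ e Y
1+q^-⊕ e X Y m = trans (cong ((X ⊕ Y) m xor_) (shift-⊕ e X Y m)) (⊕-interchange X Y (shift e X) (shift e Y) m)

1+q^-shift : ∀ a b X → 1+q^ a (shift b X) ≐ shift b (1+q^ a X)
1+q^-shift a b X m = trans (cong (shift b X m xor_) (shift-comm a b X m)) (sym (shift-⊕ b X (shift a X) m))

1+q^-comm : ∀ a b X → 1+q^ a (1+q^ b X) ≐ 1+q^ b (1+q^ a X)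
1+q^-comm a b X m = trans (1+q^-⊕ a X (shift b X) m) (cong (1+q^ a X m xor_) (1+q^-shift a b X m))

1+q^-low : ∀ e X {n} → n < e → 1+q^ e X ≈[ n ] X
1+q^-low e X n<e m m≤n = trans (cong (X m xor_) (shift-low e X (≤-trans (s≤s m≤n) n<e))) (xor-identityʳ (X m))

-- Squaring is additive in characteristic 2.
1+q^-double : ∀ e X → 1+q^ (e + e) X ≐ 1+q^ e (1+q^ e X)
1+q^-double e X m = sym (begin
  (x xor shift e X m) xor shift e (X ⊕ shift e X) m       ≡⟨ cong ((x xor y) xor_) (shift-⊕ e X (shift e X) m) ⟩
  (x xor y) xor (y xor shift e (shift e X) m)             ≡⟨ xor-assoc x y _ ⟩
  x xor (y xor (y xor shift e (shift e X) m))             ≡⟨ cong (x xor_) (xor-assoc y y _) ⟨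
  x xor ((y xor y) xor shift e (shift e X) m)             ≡⟨ cong (λ a → x xor (a xor shift e (shift e X) m)) (xor-same y) ⟩
  x xor shift e (shift e X) m                             ≡⟨ cong (x xor_) (shift-shift e e X m) ⟩
  x xor shift (e + e) X m                                 ∎)
  where
  open ≡-Reasoning
  x y : Bool
  x = X m
  y = shift e X m

∏-cong-≈ : ∀ es {n X Y} → X ≈[ n ] Y → ∏ es X ≈[ n ] ∏ es Y
∏-cong-≈ []       p = p
∏-cong-≈ (e ∷ es) p = 1+q^-cong-≈ e (∏-cong-≈ es p)

∏-cong : ∀ es {X Y} → X ≐ Y → ∏ es X ≐ ∏ es Y
∏-cong []       p = p
∏-cong (e ∷ es) p = 1+q^-cong e (∏-cong es p)

∏-⊕ : ∀ es X Y → ∏ es (X ⊕ Y) ≐ ∏ es X ⊕ ∏ es Y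
∏-⊕ []       X Y m = refl
∏-⊕ (e ∷ es) X Y = ≐-trans (1+q^-cong e (∏-⊕ es X Y)) (1+q^-⊕ e (∏ es X) (∏ es Y))

∏-shift : ∀ es b X → ∏ es (shift b X) ≐ shift b (∏ es X)
∏-shift []       b X m = refl
∏-shift (e ∷ es) b X = ≐-trans (1+q^-cong e (∏-shift es b X)) (1+q^-shift e b (∏ es X))

∏-1+q^ : ∀ es e X → ∏ es (1+q^ e X) ≐ 1+q^ e (∏ es X)
∏-1+q^ es e X m = trans (∏-⊕ es X (shift e X) m) (cong (∏ es X m xor_) (∏-shift es e X m))

∏-comm : ∀ es fs X → ∏ es (∏ fs X) ≐ ∏ fs (∏ es X)
∏-comm es []       X m = refl
∏-comm es (f ∷ fs) X = ≐-trans (∏-1+q^ es f (∏ fs X)) (1+q^-cong f (∏-comm es fs X))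

shift-below : ∀ e {X Y} m → (∀ {k} → k < m → X k ≡ Y k) → shift (suc e) X m ≡ shift (suc e) Y m
shift-below e zero    p = refl
shift-below e (suc m) p = shift-cong-≈ e (λ k k≤m → p (s≤s k≤m)) m ≤-refl

-- The factor is invertible: coefficient m of q^(e+1) X involves only coefficients of X below m, so
-- equality propagates upwards by strong induction. The exponent is a successor because 1 + q^0
-- vanishes modulo 2.
1+q^-cancel : ∀ e {n X Y} → 1+q^ (suc e) X ≈[ n ] 1+q^ (suc e) Y → X ≈[ n ] Y
1+q^-cancel e {n} {X} {Y} p = <-rec _ step
  where
  xor-cancelʳ : ∀ a b c → a xor c ≡ b xor c → a ≡ b
  xor-cancelʳ a b c eq = begin
    a                ≡⟨ xor-identityʳ a ⟨
    a xor false      ≡⟨ cong (a xor_) (xor-same c) ⟨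
    a xor (c xor c)  ≡⟨ xor-assoc a c c ⟨
    (a xor c) xor c  ≡⟨ cong (_xor c) eq ⟩
    (b xor c) xor c  ≡⟨ xor-assoc b c c ⟩
    b xor (c xor c)  ≡⟨ cong (b xor_) (xor-same c) ⟩
    b xor false      ≡⟨ xor-identityʳ b ⟩
    b                ∎
    where open ≡-Reasoning
  step : ∀ m → (∀ {k} → k < m → k ≤ n → X k ≡ Y k) → m ≤ n → X m ≡ Y m
  step m rec m≤n = xor-cancelʳ (X m) (Y m) (shift (suc e) Y m)
    (trans (cong (X m xor_) (sym (shift-below e m (λ k<m → rec k<m (≤-trans (<⇒≤ k<m) m≤n))))) (p m m≤n))

multiples : ℕ → ℕ → List ℕ
multiples c zero    = []
multiples c (suc k) = c * suc k ∷ multiples c k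

odds : ℕ → List ℕ
odds zero    = []
odds (suc k) = 2 * k + 1 ∷ odds k

∏-multiples-cancel : ∀ k {n X Y} → ∏ (multiples 1 k) X ≈[ n ] ∏ (multiples 1 k) Y → X ≈[ n ] Y
∏-multiples-cancel zero    p = p
∏-multiples-cancel (suc k) p = ∏-multiples-cancel k (1+q^-cancel (k + 0) p)

∏-multiples-double : ∀ c k X → ∏ (multiples (c + c) k) X ≐ ∏ (multiples c k) (∏ (multiples c k) X)
∏-multiples-double c zero    X m = refl
∏-multiples-double c (suc k) X m = begin
  1+q^ ((c + c) * suc k) (∏ (multiples (c + c) k) X) m
    ≡⟨ cong (λ e → 1+q^ e (∏ (multiples (c + c) k) X) m) (*-distribʳ-+ (suc k) c c) ⟩
  1+q^ (e + e) (∏ (multiples (c + c) k) X) m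
    ≡⟨ 1+q^-cong (e + e) (∏-multiples-double c k X) m ⟩
  1+q^ (e + e) (∏ (multiples c k) (∏ (multiples c k) X)) m
    ≡⟨ 1+q^-double e (∏ (multiples c k) (∏ (multiples c k) X)) m ⟩
  1+q^ e (1+q^ e (∏ (multiples c k) (∏ (multiples c k) X))) m
    ≡⟨ 1+q^-cong e (≐-sym (∏-1+q^ (multiples c k) e (∏ (multiples c k) X))) m ⟩
  1+q^ e (∏ (multiples c k) (1+q^ e (∏ (multiples c k) X))) m
    ∎
  where
  open ≡-Reasoning
  e : ℕ
  e = c * suc k

∏-multiples-stable : ∀ c n d X → ∏ (multiples (suc c) (d + n)) X ≈[ n ] ∏ (multiples (suc c) n) X
∏-multiples-stable c n zero    X m _ = refl
∏-multiples-stable c n (suc d) X = ≈-trans (1+q^-low (suc c * suc (d + n)) _ (≤-trans (s≤s (m≤n+m n d)) (m≤m+n (suc (d + n)) _)))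
  (∏-multiples-stable c n d X)

-- The odd factors are the denominator in Gauss' product for the triangular series, so the even ones
-- have to be separated from them.
∏-odd-even : ∀ h X → ∏ (multiples 1 (2 * h)) X ≐ ∏ (odds h) (∏ (multiples 2 h) X)
∏-odd-even zero    X m = refl
∏-odd-even (suc h) X m = begin
  ∏ (multiples 1 (2 * suc h)) X m
    ≡⟨ cong (λ k → ∏ (multiples 1 k) X m) (eq₀ h) ⟩
  1+q^ (1 * suc (suc (2 * h))) (1+q^ (1 * suc (2 * h)) (∏ (multiples 1 (2 * h)) X)) m
    ≡⟨ cong₂ (λ a b → 1+q^ a (1+q^ b (∏ (multiples 1 (2 * h)) X)) m) (eq₁ h) (eq₂ h) ⟩
  1+q^ a (1+q^ b (∏ (multiples 1 (2 * h)) X)) m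
    ≡⟨ 1+q^-comm a b (∏ (multiples 1 (2 * h)) X) m ⟩
  1+q^ b (1+q^ a (∏ (multiples 1 (2 * h)) X)) m
    ≡⟨ 1+q^-cong b (1+q^-cong a (∏-odd-even h X)) m ⟩
  1+q^ b (1+q^ a (∏ (odds h) (∏ (multiples 2 h) X))) m
    ≡⟨ 1+q^-cong b (≐-sym (∏-1+q^ (odds h) a (∏ (multiples 2 h) X))) m ⟩
  1+q^ b (∏ (odds h) (1+q^ a (∏ (multiples 2 h) X))) m
    ∎
  where
  open ≡-Reasoning
  a b : ℕ
  a = 2 * suc h
  b = 2 * h + 1
  eq₀ : ∀ h → 2 * suc h ≡ suc (suc (2 * h))
  eq₀ = solve-∀
  eq₁ : ∀ h → 1 * suc (suc (2 * h)) ≡ 2 * suc h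
  eq₁ = solve-∀
  eq₂ : ∀ h → 1 * suc (2 * h) ≡ 2 * h + 1
  eq₂ = solve-∀

-- sumOfPowers c es X = Σ_{e ∈ es} q^(c e) X
sumOfPowers : ℕ → List ℕ → Series → Series
sumOfPowers c es X m = ⨁ es (λ e → shift (c * e) X m)

-- Shanks' finite forms of the theorems of Euler and Gauss

-- The rearrangement common to the inductive steps of both `telescope` lemmas: it moves the factor 1
-- + q^b outside, so that the induction hypothesis appears under it.
pull-out : ∀ a b A B C S → 1+q^ a (1+q^ b A ⊕ B) ⊕ (1+q^ b C ⊕ S) ≐ 1+q^ b (1+q^ a A ⊕ C) ⊕ (1+q^ a B ⊕ S)
pull-out a b A B C S m = begin
  1+q^ a (1+q^ b A ⊕ B) m xor (1+q^ b C m xor S m)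
    ≡⟨ cong (_xor (1+q^ b C m xor S m)) (1+q^-⊕ a (1+q^ b A) B m) ⟩
  (1+q^ a (1+q^ b A) m xor 1+q^ a B m) xor (1+q^ b C m xor S m)
    ≡⟨ xor-interchange (1+q^ a (1+q^ b A) m) (1+q^ a B m) (1+q^ b C m) (S m) ⟩
  (1+q^ a (1+q^ b A) m xor 1+q^ b C m) xor (1+q^ a B m xor S m)
    ≡⟨ cong (λ t → (t xor 1+q^ b C m) xor (1+q^ a B m xor S m)) (1+q^-comm a b A m) ⟩
  (1+q^ b (1+q^ a A) m xor 1+q^ b C m) xor (1+q^ a B m xor S m)
    ≡⟨ cong (_xor (1+q^ a B m xor S m)) (1+q^-⊕ b (1+q^ a A) C m) ⟨
  1+q^ b (1+q^ a A ⊕ C) m xor (1+q^ a B m xor S m)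
    ∎
  where open ≡-Reasoning

xor-cancel₁ : ∀ a b c → (a xor b) xor (a xor c) ≡ c xor b
xor-cancel₁ a b c = trans (xor-interchange a b a c) (trans (cong (_xor (b xor c)) (xor-same a)) (xor-comm b c))

xor-cancel₂ : ∀ a b c → (a xor b) xor ((b xor c) xor a) ≡ c
xor-cancel₂ a b c = trans (cong ((a xor b) xor_) (xor-comm (b xor c) a)) (trans (xor-cancel₁ a b (b xor c))
  (trans (cong (_xor b) (xor-comm b c)) (trans (xor-assoc c b b) (trans (cong (c xor_) (xor-same b)) (xor-identityʳ c)))))

xor-cancel₃ : ∀ a b c d → (a xor b) xor ((b xor c) xor (a xor d)) ≡ d xor c
xor-cancel₃ a b c d = begin
  (a xor b) xor ((b xor c) xor (a xor d))   ≡⟨ cong ((a xor b) xor_) (trans (cong (_xor (a xor d)) (xor-comm b c)) (xor-interchange c b a d)) ⟩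
  (a xor b) xor ((c xor a) xor (b xor d))   ≡⟨ cong (λ t → (a xor b) xor (t xor (b xor d))) (xor-comm c a) ⟩
  (a xor b) xor ((a xor c) xor (b xor d))   ≡⟨ cong ((a xor b) xor_) (xor-interchange a c b d) ⟩
  (a xor b) xor ((a xor b) xor (c xor d))   ≡⟨ xor-assoc (a xor b) (a xor b) (c xor d) ⟨
  ((a xor b) xor (a xor b)) xor (c xor d)   ≡⟨ cong (_xor (c xor d)) (xor-same (a xor b)) ⟩
  c xor d                                   ≡⟨ xor-comm c d ⟩
  d xor c                                   ∎
  where open ≡-Reasoning

solve-xor : ∀ a b {c} → a xor b ≡ c → a ≡ c xor b
solve-xor a b refl = sym (trans (xor-assoc a b b) (trans (cong (a xor_) (xor-same b)) (xor-identityʳ a)))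

triangular : ℕ → ℕ
triangular zero    = 0
triangular (suc k) = suc k + triangular k

-- These are n(3n+1)/2 and, with k = n + 1, k(3k-1)/2, together the generalised pentagonal numbers.
-- They are written in the shape of the exponents produced by the telescoping.
pentagonal⁺ pentagonal⁻ : ℕ → ℕ
pentagonal⁺ n = n * n + triangular n
pentagonal⁻ n = suc n * n + triangular (suc n)

pentagonals : ℕ → List ℕ
pentagonals zero    = 0 ∷ []
pentagonals (suc n) = pentagonal⁺ (suc n) ∷ pentagonal⁻ n ∷ pentagonals n

module Euler (c : ℕ) where

  -- Write P_k for the product of 1 + q^(ci) over 1 ≤ i ≤ k. This is Shanks' sum of (P_k / P_j)
  -- q^(c(jn + j(j+1)/2)) over j ≤ k, applied to X; the recursion on k avoids the quotients, and the
  -- signs disappear modulo 2.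
  partialSum : ℕ → ℕ → Series → Series
  partialSum n zero    X = X
  partialSum n (suc k) X = 1+q^ (c * suc k) (partialSum n k X) ⊕ shift (c * (suc k * n + triangular (suc k))) X

  -- Taken at k = n, this shows that the diagonal sum for n + 1 exceeds the one for n by just two
  -- powers: the right-hand side here, with exponent c times `pentagonal⁻ n`, and the last summand,
  -- with exponent c times `pentagonal⁺ (suc n)`.
  telescope : ∀ n k X → 1+q^ (c * suc n) (partialSum (suc n) k X) ⊕ partialSum n k X ≐ shift (c * (suc k * n + triangular (suc k))) X
  telescope n zero X m = begin
    (X m xor shift (c * suc n) X m) xor X m   ≡⟨ cancel (X m) (shift (c * suc n) X m) ⟩
    shift (c * suc n) X m                     ≡⟨ cong (λ e → shift (c * e) X m) (eq n) ⟩
    shift (c * (1 * n + (1 + 0))) X m         ∎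
    where
    open ≡-Reasoning
    eq : ∀ n → suc n ≡ 1 * n + (1 + 0)
    eq = solve-∀
    cancel : ∀ a b → (a xor b) xor a ≡ b
    cancel true  true  = refl
    cancel true  false = refl
    cancel false b     = xor-identityʳ b
  telescope n (suc k) X m = begin
    (1+q^ a (1+q^ b A ⊕ shift (c * E′) X) ⊕ (1+q^ b C ⊕ shift (c * E) X)) m
      ≡⟨ pull-out a b A (shift (c * E′) X) C (shift (c * E) X) m ⟩
    1+q^ b (1+q^ a A ⊕ C) m xor (1+q^ a (shift (c * E′) X) m xor shift (c * E) X m)
      ≡⟨ cong (_xor (1+q^ a (shift (c * E′) X) m xor shift (c * E) X m)) (1+q^-cong b (telescope n k X) m) ⟩
    (s xor shift b (shift (c * E) X) m) xor ((u xor shift a (shift (c * E′) X) m) xor s)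
      ≡⟨ cong₂ (λ x y → (s xor x) xor ((u xor y) xor s)) (merge (suc k) E E′ (eq₁ n k (triangular (suc k))))
                                                          (merge (suc n) E′ E″ (eq₂ n k (triangular (suc k)))) ⟩
    (s xor u) xor ((u xor shift (c * E″) X m) xor s)
      ≡⟨ xor-cancel₂ s u (shift (c * E″) X m) ⟩
    shift (c * E″) X m
      ∎
    where
    open ≡-Reasoning
    a b E E′ E″ : ℕ
    a = c * suc n
    b = c * suc k
    E  = suc k * n + triangular (suc k)
    E′ = suc k * suc n + triangular (suc k)
    E″ = suc (suc k) * n + triangular (suc (suc k))
    A C : Series
    A = partialSum (suc n) k X
    C = partialSum n k X
    s u : Bool
    s = shift (c * E) X m
    u = shift (c * E′) X m
    merge : ∀ i E E′ → i + E ≡ E′ → shift (c * i) (shift (c * E) X) m ≡ shift (c * E′) X m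
    merge i E E′ eq = trans (shift-shift (c * i) (c * E) X m) (cong (λ e → shift e X m) (trans (sym (*-distribˡ-+ c i E)) (cong (c *_) eq)))
    eq₁ : ∀ n k t → suc k + (suc k * n + t) ≡ suc k * suc n + t
    eq₁ = solve-∀
    eq₂ : ∀ n k t → suc n + (suc k * suc n + t) ≡ suc (suc k) * n + (suc (suc k) + t)
    eq₂ = solve-∀

  partialSum-pentagonals : ∀ n X → partialSum n n X ≐ sumOfPowers c (pentagonals n) X
  partialSum-pentagonals zero X m = trans (sym (xor-identityʳ (X m))) (cong (λ e → shift e X m xor false) (sym (*-zeroʳ c)))
  partialSum-pentagonals (suc n) X m = begin
    1+q^ (c * suc n) (partialSum (suc n) n X) m xor p
      ≡⟨ cong (_xor p) (solve-xor (1+q^ (c * suc n) (partialSum (suc n) n X) m) (partialSum n n X m) (telescope n n X m)) ⟩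
    (shift (c * pentagonal⁻ n) X m xor partialSum n n X m) xor p
      ≡⟨ xor-comm _ p ⟩
    p xor (shift (c * pentagonal⁻ n) X m xor partialSum n n X m)
      ≡⟨ cong (λ t → p xor (shift (c * pentagonal⁻ n) X m xor t)) (partialSum-pentagonals n X m) ⟩
    p xor (shift (c * pentagonal⁻ n) X m xor sumOfPowers c (pentagonals n) X m)
      ∎
    where
    open ≡-Reasoning
    p : Bool
    p = shift (c * pentagonal⁺ (suc n)) X m

  -- Every summand with j ≥ 1 begins beyond q^n, so only j = 0 is left, and it is the whole product.
  partialSum-low : .{{_ : NonZero c}} → ∀ n k X → partialSum n k X ≈[ n ] ∏ (multiples c k) X
  partialSum-low n zero    X m _ = refl
  partialSum-low n (suc k) X m m≤n = trans (cong₂ _xor_ (1+q^-cong-≈ (c * suc k) (partialSum-low n k X) m m≤n) (shift-low _ X (≤-trans (s≤s m≤n) big)))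
    (xor-identityʳ _)
    where
    big : suc n ≤ c * (suc k * n + triangular (suc k))
    big = ≤-trans (≤-trans (≤-reflexive (+-comm 1 n)) (+-mono-≤ (m≤n*m n (suc k)) (s≤s z≤n))) (m≤n*m _ c)

  pentagonal-number-theorem : .{{_ : NonZero c}} → ∀ n X → ∏ (multiples c n) X ≈[ n ] sumOfPowers c (pentagonals n) X
  pentagonal-number-theorem n X = ≈-trans (≈-sym (partialSum-low n n X)) (≐⇒≈ (partialSum-pentagonals n X))

-- The triangular numbers k(k+1)/2 for k ≤ 2n, in decreasing order. They come in pairs of indices 2m
-- and 2m - 1, because one step of the telescoping yields two of them.
trianglesUpTo : ℕ → List ℕ
trianglesUpTo zero    = 0 ∷ []
trianglesUpTo (suc n) = suc n * (2 * suc n + 1) ∷ suc n * (2 * n + 1) ∷ trianglesUpTo n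

module Gauss where

  -- With E_k and O_k the products of 1 + q^(2i) and of 1 + q^(2i-1) over 1 ≤ i ≤ k, this is the sum
  -- of (E_k / E_j) O_j q^(j(2n+1)) over j ≤ k, applied to X. It is Shanks' sum multiplied by O_k to
  -- clear the denominators.
  partialSum : ℕ → ℕ → Series → Series
  partialSum n zero    X = X
  partialSum n (suc k) X = 1+q^ (2 * suc k) (partialSum n k X) ⊕ shift (suc k * (2 * n + 1)) (∏ (odds (suc k)) X)

  -- The factor 1 + q^(2n+1) on the second sum reflects the cleared denominators: it is what turns
  -- O_n into O_(n+1). At k = n the right-hand side contributes the triangular number (n+1)(2n+1).
  telescope : ∀ n k X → 1+q^ (2 * suc n) (partialSum (suc n) k X) ⊕ 1+q^ (2 * n + 1) (partialSum n k X)
                        ≐ shift (suc k * (2 * n + 1)) (∏ (odds (suc k)) X)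
  telescope n zero X m = begin
    (X m xor shift (2 * suc n) X m) xor (X m xor shift (2 * n + 1) X m)
      ≡⟨ xor-cancel₁ (X m) (shift (2 * suc n) X m) (shift (2 * n + 1) X m) ⟩
    shift (2 * n + 1) X m xor shift (2 * suc n) X m
      ≡⟨ cong₂ (λ a b → shift a X m xor shift b X m) (eq₁ n) (eq₂ n) ⟩
    shift e X m xor shift (e + 1) X m
      ≡⟨ cong (shift e X m xor_) (shift-shift e 1 X m) ⟨
    shift e X m xor shift e (shift 1 X) m
      ≡⟨ shift-⊕ e X (shift 1 X) m ⟨
    shift e (1+q^ 1 X) m
      ∎
    where
    open ≡-Reasoning
    e : ℕ
    e = 1 * (2 * n + 1)
    eq₁ : ∀ n → 2 * n + 1 ≡ 1 * (2 * n + 1)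
    eq₁ = solve-∀
    eq₂ : ∀ n → 2 * suc n ≡ 1 * (2 * n + 1) + 1
    eq₂ = solve-∀
  telescope n (suc k) X m = begin
    1+q^ a (1+q^ b A ⊕ shift E′ Y) m xor 1+q^ d (1+q^ b C ⊕ shift E Y) m
      ≡⟨ cong (1+q^ a (1+q^ b A ⊕ shift E′ Y) m xor_) (trans (1+q^-⊕ d (1+q^ b C) (shift E Y) m) (cong (_xor 1+q^ d (shift E Y) m) (1+q^-comm d b C m))) ⟩
    1+q^ a (1+q^ b A ⊕ shift E′ Y) m xor (1+q^ b (1+q^ d C) m xor 1+q^ d (shift E Y) m)
      ≡⟨ pull-out a b A (shift E′ Y) (1+q^ d C) (1+q^ d (shift E Y)) m ⟩
    1+q^ b (1+q^ a A ⊕ 1+q^ d C) m xor (1+q^ a (shift E′ Y) m xor 1+q^ d (shift E Y) m)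
      ≡⟨ cong (_xor (1+q^ a (shift E′ Y) m xor 1+q^ d (shift E Y) m)) (1+q^-cong b (telescope n k X) m) ⟩
    (s xor shift b (shift E Y) m) xor ((u xor shift a (shift E′ Y) m) xor (s xor shift d (shift E Y) m))
      ≡⟨ cong₂ (λ x y → (s xor x) xor ((u xor y) xor (s xor shift d (shift E Y) m)))
           (merge b E E′ (eq₁ n k)) (trans (merge a E′ (E″ + f) (eq₂ n k)) (sym (merge E″ f (E″ + f) refl))) ⟩
    (s xor u) xor ((u xor shift E″ (shift f Y) m) xor (s xor shift d (shift E Y) m))
      ≡⟨ cong (λ x → (s xor u) xor ((u xor shift E″ (shift f Y) m) xor (s xor x))) (merge d E E″ refl) ⟩
    (s xor u) xor ((u xor shift E″ (shift f Y) m) xor (s xor shift E″ Y m))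
      ≡⟨ xor-cancel₃ s u (shift E″ (shift f Y) m) (shift E″ Y m) ⟩
    shift E″ Y m xor shift E″ (shift f Y) m
      ≡⟨ shift-⊕ E″ Y (shift f Y) m ⟨
    shift E″ (1+q^ f Y) m
      ∎
    where
    open ≡-Reasoning
    a b d f E E′ E″ : ℕ
    a = 2 * suc n
    b = 2 * suc k
    d = 2 * n + 1
    f = 2 * suc k + 1
    E  = suc k * (2 * n + 1)
    E′ = suc k * (2 * suc n + 1)
    E″ = suc (suc k) * (2 * n + 1)
    A C Y : Series
    A = partialSum (suc n) k X
    C = partialSum n k X
    Y = ∏ (odds (suc k)) X
    s u : Bool
    s = shift E Y m
    u = shift E′ Y m
    merge : ∀ i E E′ {Y} → i + E ≡ E′ → shift i (shift E Y) m ≡ shift E′ Y m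
    merge i E E′ {Y} eq = trans (shift-shift i E Y m) (cong (λ e → shift e Y m) eq)
    eq₁ : ∀ n k → 2 * suc k + suc k * (2 * n + 1) ≡ suc k * (2 * suc n + 1)
    eq₁ = solve-∀
    eq₂ : ∀ n k → 2 * suc n + suc k * (2 * suc n + 1) ≡ suc (suc k) * (2 * n + 1) + (2 * suc k + 1)
    eq₂ = solve-∀

  partialSum-triangles : ∀ n X → partialSum n n X ≐ ∏ (odds n) (sumOfPowers 1 (trianglesUpTo n) X)
  partialSum-triangles zero X m = sym (xor-identityʳ (X m))
  partialSum-triangles (suc n) X m = begin
    1+q^ (2 * suc n) (partialSum (suc n) n X) m xor shift t₂ Y m
      ≡⟨ cong (_xor shift t₂ Y m) (solve-xor (1+q^ (2 * suc n) (partialSum (suc n) n X) m) (1+q^ (2 * n + 1) (partialSum n n X) m) (telescope n n X m)) ⟩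
    (shift t₁ Y m xor 1+q^ (2 * n + 1) (partialSum n n X) m) xor shift t₂ Y m
      ≡⟨ xor-comm _ (shift t₂ Y m) ⟩
    shift t₂ Y m xor (shift t₁ Y m xor 1+q^ (2 * n + 1) (partialSum n n X) m)
      ≡⟨ cong (λ x → shift t₂ Y m xor (shift t₁ Y m xor x)) (1+q^-cong (2 * n + 1) (partialSum-triangles n X) m) ⟩
    shift t₂ Y m xor (shift t₁ Y m xor ∏ (odds (suc n)) Z m)
      ≡⟨ cong₂ (λ x y → x xor (y xor ∏ (odds (suc n)) Z m)) (∏-power t₂) (∏-power t₁) ⟨
    ∏ (odds (suc n)) (shift (1 * t₂) X) m xor (∏ (odds (suc n)) (shift (1 * t₁) X) m xor ∏ (odds (suc n)) Z m)
      ≡⟨ cong (∏ (odds (suc n)) (shift (1 * t₂) X) m xor_) (∏-⊕ (odds (suc n)) (shift (1 * t₁) X) Z m) ⟨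
    ∏ (odds (suc n)) (shift (1 * t₂) X) m xor ∏ (odds (suc n)) (shift (1 * t₁) X ⊕ Z) m
      ≡⟨ ∏-⊕ (odds (suc n)) (shift (1 * t₂) X) (shift (1 * t₁) X ⊕ Z) m ⟨
    ∏ (odds (suc n)) (sumOfPowers 1 (trianglesUpTo (suc n)) X) m
      ∎
    where
    open ≡-Reasoning
    t₁ t₂ : ℕ
    t₁ = suc n * (2 * n + 1)
    t₂ = suc n * (2 * suc n + 1)
    Y Z : Series
    Y = ∏ (odds (suc n)) X
    Z = sumOfPowers 1 (trianglesUpTo n) X
    ∏-power : ∀ t → ∏ (odds (suc n)) (shift (1 * t) X) m ≡ shift t Y m
    ∏-power t = trans (∏-shift (odds (suc n)) (1 * t) X m) (cong (λ e → shift e Y m) (*-identityˡ t))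

  partialSum-low : ∀ n k X → partialSum n k X ≈[ n ] ∏ (multiples 2 k) X
  partialSum-low n zero    X m _ = refl
  partialSum-low n (suc k) X m m≤n = trans
    (cong₂ _xor_ (1+q^-cong-≈ (2 * suc k) (partialSum-low n k X) m m≤n) (shift-low _ (∏ (odds (suc k)) X) (≤-trans (s≤s m≤n) big)))
    (xor-identityʳ _)
    where
    big : suc n ≤ suc k * (2 * n + 1)
    big = ≤-trans (≤-trans (≤-reflexive (+-comm 1 n)) (+-monoˡ-≤ 1 (m≤n*m n 2))) (m≤n*m (2 * n + 1) (suc k))

  triangular-number-theorem : ∀ n X → ∏ (odds n) (sumOfPowers 1 (trianglesUpTo n) X) ≈[ n ] ∏ (multiples 2 n) X
  triangular-number-theorem n X = ≈-trans (≐⇒≈ (≐-sym (partialSum-triangles n X))) (partialSum-low n n X)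

-- The generating series of b₈ modulo 2

oddℕ-+ : ∀ a b → oddℕ (a + b) ≡ oddℕ a xor oddℕ b
oddℕ-+ zero    b = refl
oddℕ-+ (suc a) b = trans (cong not (oddℕ-+ a b)) (not-distribˡ-xor (oddℕ a) (oddℕ b))

multLoop-small : ∀ d k n f → n < suc k → multLoop d k n f ≡ regCount d k n
multLoop-small d k n zero    _ = refl
multLoop-small d k n (suc f) n<k with n <ᵇ suc k in eq
... | true  = refl
... | false = ⊥-elim (subst T eq (<⇒<ᵇ n<k))

multLoop-large : ∀ d k r f → multLoop d k (suc k + r) (suc f) ≡ regCount d k (suc k + r) + multLoop d k r f
multLoop-large d k r f with (suc k + r) <ᵇ suc k in eq
... | true  = ⊥-elim (<-irrefl refl (≤-trans (<ᵇ⇒< (suc k + r) (suc k) (subst T (sym eq) tt)) (m≤m+n (suc k) r)))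
... | false = cong (λ t → regCount d k (suc k + r) + multLoop d k t f) (m+n∸m≡n (suc k) r)

≤-or-+ : ∀ k n → n < suc k ⊎ (∃[ r ] n ≡ suc k + r)
≤-or-+ k n with <-≤-connex n (suc k)
... | inj₁ p = inj₁ p
... | inj₂ p = inj₂ (n ∸ suc k , sym (m+[n∸m]≡n p))

-- One step of the loop lowers the argument by `suc k` but the fuel by one. The tail is the loop for
-- the remainder only because surplus fuel does not affect the value.
multLoop-fuel : ∀ d k f f′ n → n ≤ f → n ≤ f′ → multLoop d k n f ≡ multLoop d k n f′
multLoop-fuel d k f f′ n n≤f n≤f′ with ≤-or-+ k n
... | inj₁ n<k = trans (multLoop-small d k n f n<k) (sym (multLoop-small d k n f′ n<k))
multLoop-fuel d k (suc f) (suc f′) _ (s≤s p) (s≤s p′) | inj₂ (r , refl) = trans (multLoop-large d k r f)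
  (trans (cong (regCount d k (suc k + r) +_) (multLoop-fuel d k f f′ r (≤-trans (m≤n+m r k) p) (≤-trans (m≤n+m r k) p′)))
    (sym (multLoop-large d k r f′)))

partitions : ℕ → Series
partitions k n = oddℕ (regCount 8 k n)

shift-at : ∀ e X r → shift e X (e + r) ≡ X r
shift-at zero    X r = refl
shift-at (suc e) X r = shift-at e X r

partitions-8∣ : ∀ k → (suc k % 8 ≡ᵇ 0) ≡ true → partitions (suc k) ≐ partitions k
partitions-8∣ k eq n rewrite eq = refl

-- Allowing the part k + 1 divides the generating series by 1 - q^(k+1), which is 1 + q^(k+1) modulo
-- 2. In terms of the loop: its value at k + 1 + r is the term of multiplicity zero plus its value
-- at r.
partitions-8∤ : ∀ k → (suc k % 8 ≡ᵇ 0) ≡ false → 1+q^ (suc k) (partitions (suc k)) ≐ partitions k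
partitions-8∤ k eq n = trans (cong₂ _xor_ (loop n) (shift-cong (suc k) loop n)) (unfold (≤-or-+ k n))
  where
  L : Series
  L n = oddℕ (multLoop 8 k n n)
  loop : partitions (suc k) ≐ L
  loop n rewrite eq = refl
  unfold : n < suc k ⊎ (∃[ r ] n ≡ suc k + r) → L n xor shift (suc k) L n ≡ partitions k n
  unfold (inj₁ n<k) = trans (cong₂ _xor_ (cong oddℕ (multLoop-small 8 k n n n<k)) (shift-low (suc k) L n<k)) (xor-identityʳ _)
  unfold (inj₂ (r , refl)) = begin
    L (suc k + r) xor shift (suc k) L (suc k + r)
      ≡⟨ cong₂ _xor_ (cong oddℕ (multLoop-large 8 k r (k + r))) (shift-at (suc k) L r) ⟩
    oddℕ (regCount 8 k (suc k + r) + multLoop 8 k r (k + r)) xor L r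
      ≡⟨ cong (_xor L r) (oddℕ-+ (regCount 8 k (suc k + r)) _) ⟩
    (partitions k (suc k + r) xor oddℕ (multLoop 8 k r (k + r))) xor L r
      ≡⟨ cong (λ t → (partitions k (suc k + r) xor oddℕ t) xor L r) (multLoop-fuel 8 k (k + r) r r (m≤n+m r k) ≤-refl) ⟩
    (partitions k (suc k + r) xor L r) xor L r
      ≡⟨ sym (solve-xor (partitions k (suc k + r)) (L r) refl) ⟩
    partitions k (suc k + r)
      ∎
    where open ≡-Reasoning

partitions-stable : ∀ d n → partitions (d + n) n ≡ partitions n n
partitions-stable zero    n = refl
partitions-stable (suc d) n with (suc (d + n) % 8 ≡ᵇ 0)
... | true  = partitions-stable d n
... | false = trans (cong oddℕ (multLoop-small 8 (d + n) n n (s≤s (m≤n+m n d)))) (partitions-stable d n)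

-- The test is that of `regCount`, so that `∏-partitions` splits into the same two cases on both
-- sides.
eights : ℕ → List ℕ
eights zero    = []
eights (suc k) = if suc k % 8 ≡ᵇ 0 then suc k ∷ eights k else eights k

∏-partitions : ∀ k → ∏ (multiples 1 k) (partitions k) ≐ ∏ (eights k) one
∏-partitions zero    zero    = refl
∏-partitions zero    (suc m) = refl
∏-partitions (suc k) m = trans
  (cong (λ e → 1+q^ e (∏ (multiples 1 k) (partitions (suc k))) m) (*-identityˡ (suc k)))
  (cases (suc k % 8 ≡ᵇ 0) refl)
  where
  open ≡-Reasoning
  cases : ∀ b → (suc k % 8 ≡ᵇ 0) ≡ b → 1+q^ (suc k) (∏ (multiples 1 k) (partitions (suc k))) m ≡ ∏ (eights (suc k)) one m
  cases true eq = begin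
    1+q^ (suc k) (∏ (multiples 1 k) (partitions (suc k))) m       ≡⟨ 1+q^-cong (suc k) (∏-cong (multiples 1 k) (partitions-8∣ k eq)) m ⟩
    1+q^ (suc k) (∏ (multiples 1 k) (partitions k)) m             ≡⟨ 1+q^-cong (suc k) (∏-partitions k) m ⟩
    ∏ (suc k ∷ eights k) one m                                    ≡⟨ cong (λ b → ∏ (if b then suc k ∷ eights k else eights k) one m) eq ⟨
    ∏ (eights (suc k)) one m                                      ∎
  cases false eq = begin
    1+q^ (suc k) (∏ (multiples 1 k) (partitions (suc k))) m       ≡⟨ ∏-1+q^ (multiples 1 k) (suc k) (partitions (suc k)) m ⟨
    ∏ (multiples 1 k) (1+q^ (suc k) (partitions (suc k))) m       ≡⟨ ∏-cong (multiples 1 k) (partitions-8∤ k eq) m ⟩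
    ∏ (multiples 1 k) (partitions k) m                            ≡⟨ ∏-partitions k m ⟩
    ∏ (eights k) one m                                            ≡⟨ cong (λ b → ∏ (if b then suc k ∷ eights k else eights k) one m) eq ⟨
    ∏ (eights (suc k)) one m                                      ∎

[i+8n]%8 : ∀ i n → (i + n * 8) % 8 ≡ i % 8
[i+8n]%8 i n = [m+kn]%n≡m%n i n 8

eights-multiples : ∀ n → eights (n * 8) ≡ multiples 8 n
eights-multiples zero    = refl
eights-multiples (suc n)
  rewrite [i+8n]%8 8 n | [i+8n]%8 7 n | [i+8n]%8 6 n | [i+8n]%8 5 n | [i+8n]%8 4 n | [i+8n]%8 3 n | [i+8n]%8 2 n | [i+8n]%8 1 n =
  cong₂ _∷_ (*-comm (suc n) 8) (eights-multiples n)

-- The two sides agree after multiplication by the factors 1 + q^i with i ≤ 8n, which can be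
-- cancelled. On the left the partition denominators disappear, leaving ∏ (1 + q^8i) = ∏ (1 +
-- q^4i)². On the right the odd factors turn the triangular series into ∏ (1 + q^2i); with the even
-- factors this makes ∏ (1 + q^4i), and `Y` holds a second copy. The bound 8n makes `eights` exactly
-- n multiples of 8; its half 4n counts the odd and the even factors.
partitions-product : ∀ n → partitions (n * 8) ≈[ n ] sumOfPowers 1 (trianglesUpTo (4 * n)) (sumOfPowers 4 (pentagonals n) one)
partitions-product n = ≈-trans
  (∏-multiples-cancel (n * 8) {n} {partitions (n * 8)} {Ψ Y} (≈-trans (≐⇒≈ left) (≈-sym right)))
  (λ m m≤n → ⨁-cong (trianglesUpTo (4 * n)) (λ {t} _ → shift-cong-≈ (1 * t) (Euler.pentagonal-number-theorem 4 n one) m m≤n))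
  where
  h : ℕ
  h = 4 * n
  Y : Series
  Y = ∏ (multiples 4 n) one
  Ψ : Series → Series
  Ψ = sumOfPowers 1 (trianglesUpTo h)
  left : ∏ (multiples 1 (n * 8)) (partitions (n * 8)) ≐ ∏ (multiples 4 n) Y
  left m = trans (∏-partitions (n * 8) m) (trans (cong (λ es → ∏ es one m) (eights-multiples n)) (∏-multiples-double 4 n one m))
  n8≡2h : ∀ n → n * 8 ≡ 2 * (4 * n)
  n8≡2h = solve-∀
  h≡ : ∀ n → 4 * n ≡ 3 * n + n
  h≡ = solve-∀
  right : ∏ (multiples 1 (n * 8)) (Ψ Y) ≈[ n ] ∏ (multiples 4 n) Y
  right m m≤n = begin
    ∏ (multiples 1 (n * 8)) (Ψ Y) m              ≡⟨ cong (λ k → ∏ (multiples 1 k) (Ψ Y) m) (n8≡2h n) ⟩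
    ∏ (multiples 1 (2 * h)) (Ψ Y) m              ≡⟨ ∏-odd-even h (Ψ Y) m ⟩
    ∏ (odds h) (∏ (multiples 2 h) (Ψ Y)) m       ≡⟨ ∏-comm (odds h) (multiples 2 h) (Ψ Y) m ⟩
    ∏ (multiples 2 h) (∏ (odds h) (Ψ Y)) m       ≡⟨ ∏-cong-≈ (multiples 2 h) (Gauss.triangular-number-theorem h Y) m (≤-trans m≤n (m≤m+n n _)) ⟩
    ∏ (multiples 2 h) (∏ (multiples 2 h) Y) m    ≡⟨ ∏-multiples-double 2 h Y m ⟨
    ∏ (multiples 4 h) Y m                        ≡⟨ cong (λ k → ∏ (multiples 4 k) Y m) (h≡ n) ⟩
    ∏ (multiples 4 (3 * n + n)) Y m              ≡⟨ ∏-multiples-stable 3 n (3 * n) Y m m≤n ⟩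
    ∏ (multiples 4 n) Y m                        ∎
    where open ≡-Reasoning

b8-odd : ∀ n → oddℕ (b8 n) ≡ sumOfPowers 1 (trianglesUpTo (4 * n)) (sumOfPowers 4 (pentagonals n) one) n
b8-odd n = trans (sym (trans (cong (λ k → partitions k n) (n8≡ n)) (partitions-stable (n * 7) n))) (partitions-product n n ≤-refl)
  where
  n8≡ : ∀ n → n * 8 ≡ n * 7 + n
  n8≡ = solve-∀

open NaturalSolutions
open Enumeration

-- Triangular and pentagonal numbers, recognised by 8t + 1 = x² and 24e + 1 = y²

2triangular : ∀ k → 2 * triangular k ≡ k * suc k
2triangular zero    = refl
2triangular (suc k) = trans (split k (triangular k)) (trans (cong (2 * suc k +_) (2triangular k)) (eq k))
  where
  split : ∀ k t → 2 * (suc k + t) ≡ 2 * suc k + 2 * t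
  split = solve-∀
  eq : ∀ k → 2 * suc k + k * suc k ≡ suc k * suc (suc k)
  eq = solve-∀

8[m[2m+1]]+1 : ∀ m → 8 * (m * (2 * m + 1)) + 1 ≡ (1 + m * 4) * (1 + m * 4)
8[m[2m+1]]+1 = solve-∀

8[[1+m][2m+1]]+1 : ∀ m → 8 * (suc m * (2 * m + 1)) + 1 ≡ (3 + m * 4) * (3 + m * 4)
8[[1+m][2m+1]]+1 = solve-∀

24pentagonal⁺+1 : ∀ m → 24 * pentagonal⁺ m + 1 ≡ (1 + m * 6) * (1 + m * 6)
24pentagonal⁺+1 m = trans (split m (triangular m)) (trans (cong (λ t → 24 * (m * m) + 12 * t + 1) (2triangular m)) (eq m))
  where
  split : ∀ m t → 24 * (m * m + t) + 1 ≡ 24 * (m * m) + 12 * (2 * t) + 1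
  split = solve-∀
  eq : ∀ m → 24 * (m * m) + 12 * (m * suc m) + 1 ≡ (1 + m * 6) * (1 + m * 6)
  eq = solve-∀

24pentagonal⁻+1 : ∀ m → 24 * pentagonal⁻ m + 1 ≡ (5 + m * 6) * (5 + m * 6)
24pentagonal⁻+1 m = trans (split m (triangular (suc m))) (trans (cong (λ t → 24 * (suc m * m) + 12 * t + 1) (2triangular (suc m))) (eq m))
  where
  split : ∀ m t → 24 * (suc m * m + t) + 1 ≡ 24 * (suc m * m) + 12 * (2 * t) + 1
  split = solve-∀
  eq : ∀ m → 24 * (suc m * m) + 12 * (suc m * suc (suc m)) + 1 ≡ (5 + m * 6) * (5 + m * 6)
  eq = solve-∀

triangle-square : ∀ h {t} → t ∈ trianglesUpTo h → ∃[ x ] 8 * t + 1 ≡ x * x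
triangle-square zero    (here refl)         = 1 , refl
triangle-square (suc h) (here refl)         = 1 + suc h * 4 , 8[m[2m+1]]+1 (suc h)
triangle-square (suc h) (there (here refl)) = 3 + h * 4 , 8[[1+m][2m+1]]+1 h
triangle-square (suc h) (there (there t∈))  = triangle-square h t∈

pentagonal-square : ∀ h {e} → e ∈ pentagonals h → ∃[ y ] 24 * e + 1 ≡ y * y
pentagonal-square zero    (here refl)         = 1 , refl
pentagonal-square (suc h) (here refl)         = 1 + suc h * 6 , 24pentagonal⁺+1 (suc h)
pentagonal-square (suc h) (there (here refl)) = 5 + h * 6 , 24pentagonal⁻+1 h
pentagonal-square (suc h) (there (there e∈))  = pentagonal-square h e∈

m[2m+1]∈triangles : ∀ {m} h → m ≤ h → m * (2 * m + 1) ∈ trianglesUpTo h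
m[2m+1]∈triangles zero    z≤n = here refl
m[2m+1]∈triangles (suc h) m≤h with m≤n⇒m<n∨m≡n m≤h
... | inj₁ (s≤s m≤h′) = there (there (m[2m+1]∈triangles h m≤h′))
... | inj₂ refl       = here refl

[1+m][2m+1]∈triangles : ∀ {m} h → m < h → suc m * (2 * m + 1) ∈ trianglesUpTo h
[1+m][2m+1]∈triangles (suc h) m<h with m≤n⇒m<n∨m≡n m<h
... | inj₁ (s≤s m<h′) = there (there ([1+m][2m+1]∈triangles h m<h′))
... | inj₂ refl       = there (here refl)

pentagonal⁺∈ : ∀ {m} h → m ≤ h → pentagonal⁺ m ∈ pentagonals h
pentagonal⁺∈ zero    z≤n = here refl
pentagonal⁺∈ (suc h) m≤h with m≤n⇒m<n∨m≡n m≤h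
... | inj₁ (s≤s m≤h′) = there (there (pentagonal⁺∈ h m≤h′))
... | inj₂ refl       = here refl

pentagonal⁻∈ : ∀ {m} h → m < h → pentagonal⁻ m ∈ pentagonals h
pentagonal⁻∈ (suc h) m<h with m≤n⇒m<n∨m≡n m<h
... | inj₁ (s≤s m<h′) = there (there (pentagonal⁻∈ h m<h′))
... | inj₂ refl       = there (here refl)

m≤triangular : ∀ m → m ≤ triangular m
m≤triangular zero    = z≤n
m≤triangular (suc m) = m≤m+n (suc m) (triangular m)

-- The roots 4q + 1 and 4q + 3 belong to the triangular numbers of index 2q and 2q + 1. Membership
-- follows from t ≤ h because q, respectively q + 1, is at most t.
square-triangle : ∀ x → (x * x) % 4 ≡ 1 → ∃[ t ] (8 * t + 1 ≡ x * x × (∀ h → t ≤ h → t ∈ trianglesUpTo h))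
square-triangle x eq = cases (x % 4) (m%n<n x 4) (trans (sym (%-distribˡ-* x x 4)) eq) (m≡m%n+[m/n]*n x 4)
  where
  q : ℕ
  q = x / 4
  cases : ∀ r → r < 4 → (r * r) % 4 ≡ 1 → x ≡ r + q * 4 → ∃[ t ] (8 * t + 1 ≡ x * x × (∀ h → t ≤ h → t ∈ trianglesUpTo h))
  cases 0 _ ()
  cases 1 _ _ x≡ = q * (2 * q + 1) , trans (8[m[2m+1]]+1 q) (cong₂ _*_ (sym x≡) (sym x≡)) ,
    λ h t≤h → m[2m+1]∈triangles h (≤-trans (subst (λ k → q ≤ q * k) (+-comm 1 (2 * q)) (m≤m*n q (suc (2 * q)))) t≤h)
  cases 2 _ ()
  cases 3 _ _ x≡ = suc q * (2 * q + 1) , trans (8[[1+m][2m+1]]+1 q) (cong₂ _*_ (sym x≡) (sym x≡)) ,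
    λ h t≤h → [1+m][2m+1]∈triangles h (≤-trans (subst (λ k → suc q ≤ suc q * k) (+-comm 1 (2 * q)) (m≤m*n (suc q) (suc (2 * q)))) t≤h)
  cases (suc (suc (suc (suc _)))) (s≤s (s≤s (s≤s (s≤s ()))))

-- The roots 6q + 1 and 6q + 5 = 6(q+1) - 1 belong to the two families q(3q+1)/2 and k(3k-1)/2 with
-- k = q + 1.
square-pentagonal : ∀ y → (y * y) % 6 ≡ 1 → ∃[ e ] (24 * e + 1 ≡ y * y × (∀ h → e ≤ h → e ∈ pentagonals h))
square-pentagonal y eq = cases (y % 6) (m%n<n y 6) (trans (sym (%-distribˡ-* y y 6)) eq) (m≡m%n+[m/n]*n y 6)
  where
  q : ℕ
  q = y / 6
  cases : ∀ r → r < 6 → (r * r) % 6 ≡ 1 → y ≡ r + q * 6 → ∃[ e ] (24 * e + 1 ≡ y * y × (∀ h → e ≤ h → e ∈ pentagonals h))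
  cases 0 _ ()
  cases 1 _ _ y≡ = pentagonal⁺ q , trans (24pentagonal⁺+1 q) (cong₂ _*_ (sym y≡) (sym y≡)) ,
    λ h e≤h → pentagonal⁺∈ h (≤-trans (≤-trans (m≤triangular q) (m≤n+m _ (q * q))) e≤h)
  cases 2 _ ()
  cases 3 _ ()
  cases 4 _ ()
  cases 5 _ _ y≡ = pentagonal⁻ q , trans (24pentagonal⁻+1 q) (cong₂ _*_ (sym y≡) (sym y≡)) ,
    λ h e≤h → pentagonal⁻∈ h (≤-trans (≤-trans (m≤triangular (suc q)) (m≤n+m _ (suc q * q))) e≤h)
  cases (suc (suc (suc (suc (suc (suc _)))))) (s≤s (s≤s (s≤s (s≤s (s≤s (s≤s ()))))))

unique-above : ∀ {xs : List ℕ} {b x} → (∀ {y} → y ∈ xs → y ≤ b) → b < x → Unique xs → Unique (x ∷ xs)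
unique-above bounded b<x u = All.tabulate (λ y∈ x≡y → <-irrefl refl (≤-trans (subst (_ <_) x≡y b<x) (bounded y∈))) ∷ u

triangles-bounded : ∀ h {t} → t ∈ trianglesUpTo h → t ≤ h * (2 * h + 1)
triangles-step₁ : ∀ h → h * (2 * h + 1) < suc h * (2 * h + 1)
triangles-step₂ : ∀ h → suc h * (2 * h + 1) < suc h * (2 * suc h + 1)
triangles-step₁ h = m<n+m (h * (2 * h + 1)) (m≤n+m 1 (2 * h))
triangles-step₂ h = subst (suc h * (2 * h + 1) <_) (eq h) (m<n+m (suc h * (2 * h + 1)) {2 * suc h} (s≤s z≤n))
  where
  eq : ∀ h → 2 * suc h + suc h * (2 * h + 1) ≡ suc h * (2 * suc h + 1)
  eq = solve-∀
triangles-bounded zero    (here refl)         = z≤n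
triangles-bounded (suc h) (here refl)         = ≤-refl
triangles-bounded (suc h) (there (here refl)) = <⇒≤ (triangles-step₂ h)
triangles-bounded (suc h) (there (there t∈))  = ≤-trans (triangles-bounded h t∈) (<⇒≤ (<-trans (triangles-step₁ h) (triangles-step₂ h)))

triangles-unique : ∀ h → Unique (trianglesUpTo h)
triangles-unique zero    = [] ∷ []
triangles-unique (suc h) = unique-above bounded (triangles-step₂ h) (unique-above (triangles-bounded h) (triangles-step₁ h) (triangles-unique h))
  where
  bounded : ∀ {t} → t ∈ suc h * (2 * h + 1) ∷ trianglesUpTo h → t ≤ suc h * (2 * h + 1)
  bounded (here refl) = ≤-refl
  bounded (there t∈)  = ≤-trans (triangles-bounded h t∈) (<⇒≤ (triangles-step₁ h))

pentagonal-step₁ : ∀ h → pentagonal⁺ h < pentagonal⁻ h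
pentagonal-step₁ h = subst (pentagonal⁺ h <_) (eq h (triangular h)) (m<n+m (pentagonal⁺ h) {h + suc h} (≤-trans (s≤s z≤n) (m≤n+m (suc h) h)))
  where
  eq : ∀ h t → h + suc h + (h * h + t) ≡ suc h * h + (suc h + t)
  eq = solve-∀

pentagonal-step₂ : ∀ h → pentagonal⁻ h < pentagonal⁺ (suc h)
pentagonal-step₂ h = subst (pentagonal⁻ h <_) (eq h (triangular (suc h))) (m<n+m (pentagonal⁻ h) {suc h} (s≤s z≤n))
  where
  eq : ∀ h t → suc h + (suc h * h + t) ≡ suc h * suc h + t
  eq = solve-∀

pentagonals-bounded : ∀ h {e} → e ∈ pentagonals h → e ≤ pentagonal⁺ h
pentagonals-bounded zero    (here refl)         = z≤n
pentagonals-bounded (suc h) (here refl)         = ≤-refl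
pentagonals-bounded (suc h) (there (here refl)) = <⇒≤ (pentagonal-step₂ h)
pentagonals-bounded (suc h) (there (there e∈))  = ≤-trans (pentagonals-bounded h e∈) (<⇒≤ (<-trans (pentagonal-step₁ h) (pentagonal-step₂ h)))

pentagonals-unique : ∀ h → Unique (pentagonals h)
pentagonals-unique zero    = [] ∷ []
pentagonals-unique (suc h) = unique-above bounded (pentagonal-step₂ h) (unique-above (pentagonals-bounded h) (pentagonal-step₁ h) (pentagonals-unique h))
  where
  bounded : ∀ {e} → e ∈ pentagonal⁻ h ∷ pentagonals h → e ≤ pentagonal⁻ h
  bounded (here refl) = ≤-refl
  bounded (there e∈)  = ≤-trans (pentagonals-bounded h e∈) (<⇒≤ (pentagonal-step₁ h))

-- From coefficients of the product to representations 3x² + 4y²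

members : ∀ {A : Set} {xs : List A} → Unique xs → Enumeration (_∈ xs)
members {xs = xs} u = record { list = xs ; unique = u ; sound = λ x∈ → x∈ ; complete = λ x∈ → x∈ }

IsSplitting : ℕ → ℕ × ℕ → Set
IsSplitting n z = (proj₁ z ∈ trianglesUpTo (4 * n) × proj₂ z ∈ pentagonals n) × proj₁ z + 4 * proj₂ z ≡ n

splittings : ∀ n → Enumeration (IsSplitting n)
splittings n = restrict (members (triangles-unique (4 * n)) ⊗ members (pentagonals-unique n)) (λ z → proj₁ z + 4 * proj₂ z ≟ n)

shift-⨁ : ∀ {A : Set} a (xs : List A) (F : A → Series) n → shift a (λ m → ⨁ xs (λ x → F x m)) n ≡ ⨁ xs (λ x → shift a (F x) n)
shift-⨁ a []       F n = shift-zero a n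
  where
  shift-zero : ∀ a n → shift a (λ _ → false) n ≡ false
  shift-zero zero    n       = refl
  shift-zero (suc a) zero    = refl
  shift-zero (suc a) (suc n) = shift-zero a n
shift-⨁ a (x ∷ xs) F n = trans (shift-⊕ a (F x) (λ m → ⨁ xs (λ x → F x m)) n) (cong (shift a (F x) n xor_) (shift-⨁ a xs F n))

shift-one : ∀ e n → shift e one n ≡ does (e ≟ n)
shift-one zero    zero    = refl
shift-one zero    (suc n) = refl
shift-one (suc e) zero    = refl
shift-one (suc e) (suc n) = shift-one e n

b8-splittings : ∀ n → oddℕ (b8 n) ≡ parity (splittings n)
b8-splittings n = begin
  oddℕ (b8 n)
    ≡⟨ b8-odd n ⟩
  ⨁ ts (λ t → shift (1 * t) (sumOfPowers 4 es one) n)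
    ≡⟨ ⨁-cong ts (λ {t} _ → trans (shift-⨁ (1 * t) es (λ e → shift (4 * e) one) n) (⨁-cong es (λ {e} _ → term t e))) ⟩
  ⨁ ts (λ t → ⨁ es (λ e → does (t + 4 * e ≟ n)))
    ≡⟨ ⨁-× ts es (λ z → does (proj₁ z + 4 * proj₂ z ≟ n)) ⟨
  ⨁ (cartesianProduct ts es) (λ z → does (proj₁ z + 4 * proj₂ z ≟ n))
    ≡⟨ odd#-filter (λ z → proj₁ z + 4 * proj₂ z ≟ n) (cartesianProduct ts es) ⟨
  parity (splittings n)
    ∎
  where
  open ≡-Reasoning
  ts es : List ℕ
  ts = trianglesUpTo (4 * n)
  es = pentagonals n
  term : ∀ t e → shift (1 * t) (shift (4 * e) one) n ≡ does (t + 4 * e ≟ n)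
  term t e = trans (shift-shift (1 * t) (4 * e) one n)
    (trans (cong (λ k → shift (k + 4 * e) one n) (*-identityˡ t)) (shift-one (t + 4 * e) n))

representations : ∀ n → Enumeration (IsRepresentation n)
representations n = enumeration-⇔
  (restrict (below (24 * n + 8) ⊗ below (24 * n + 8)) (λ (x , y) → (0 <? x) ×-dec (0 <? y) ×-dec (3 * (x * x) + 4 * (y * y) ≟ 24 * n + 7)))
  proj₂
  (λ { {x , y} r@(px , py , eq) → let x< , y< , _ = solution-bounded {n} (isSolution px py py eq) in (x< , y<) , r })

Squared : ℕ × ℕ → ℕ × ℕ → Set
Squared (t , e) (x , y) = 8 * t + 1 ≡ x * x × 24 * e + 1 ≡ y * y

-- Completing squares explains the number 24n + 7: for n = t + 4e one has 3(8t + 1) + 4(24e + 1) =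
-- 24n + 7.
splittings-parity : ∀ n → parity (splittings n) ≡ parity (representations n)
splittings-parity n = parity-bijection (splittings n) (representations n) {Squared}
  (λ (t , e) (x , y) → (8 * t + 1 ≟ x * x) ×-dec (24 * e + 1 ≟ y * y))
  total
  (λ { _ _ _ (a , b) (a′ , b′) → cong₂ _,_ (square-injective (trans (sym a) a′)) (square-injective (trans (sym b) b′)) })
  surjective
  (λ { {t , e} {t′ , e′} _ _ _ (a , b) (a′ , b′) →
       cong₂ _,_ (*-cancelˡ-≡ t t′ 8 (+-cancelʳ-≡ 1 _ _ (trans a (sym a′)))) (*-cancelˡ-≡ e e′ 24 (+-cancelʳ-≡ 1 _ _ (trans b (sym b′)))) })
  where
  root>0 : ∀ {k} x → k + 1 ≡ x * x → 0 < x
  root>0 {k} zero    eq with trans (+-comm 1 k) eq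
  ... | ()
  root>0 (suc x) _ = s≤s z≤n

  total : ∀ {z} → IsSplitting n z → ∃[ r ] (IsRepresentation n r × Squared z r)
  total {t , e} ((t∈ , e∈) , eq) with triangle-square (4 * n) t∈ | pentagonal-square n e∈
  ... | x , x² | y , y² = (x , y) , (root>0 x x² , root>0 y y² , equation) , x² , y²
    where
    combine : ∀ t e → 3 * (8 * t + 1) + 4 * (24 * e + 1) ≡ 24 * (t + 4 * e) + 7
    combine = solve-∀
    equation : 3 * (x * x) + 4 * (y * y) ≡ 24 * n + 7
    equation = trans (cong₂ (λ a b → 3 * a + 4 * b) (sym x²) (sym y²)) (trans (combine t e) (cong (λ k → 24 * k + 7) eq))

  surjective : ∀ {r} → IsRepresentation n r → ∃[ z ] (IsSplitting n z × Squared z r)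
  surjective {x , y} (_ , _ , eq) = assemble (square-triangle x x²%4)
    where
    residues : ∀ s → s < 4 → (3 * s) % 4 ≡ 3 → s ≡ 1
    residues 0 _ ()
    residues 1 _ _ = refl
    residues 2 _ ()
    residues 3 _ ()
    residues (suc (suc (suc (suc _)))) (s≤s (s≤s (s≤s (s≤s ()))))
    -- Modulo 4 the equation reads 3x² ≡ 3.
    x²%4 : (x * x) % 4 ≡ 1
    x²%4 = residues ((x * x) % 4) (m%n<n (x * x) 4) (begin
      (3 * ((x * x) % 4)) % 4              ≡⟨ %-distribˡ-* 3 (x * x) 4 ⟨
      (3 * (x * x)) % 4                    ≡⟨ [m+kn]%n≡m%n (3 * (x * x)) (y * y) 4 ⟨
      (3 * (x * x) + y * y * 4) % 4        ≡⟨ cong (λ k → (3 * (x * x) + k) % 4) (*-comm (y * y) 4) ⟩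
      (3 * (x * x) + 4 * (y * y)) % 4      ≡⟨ cong (_% 4) eq ⟩
      (24 * n + 7) % 4                     ≡⟨ 24n+7%4≡3 n ⟩
      3                                    ∎)
      where open ≡-Reasoning
    assemble : ∃[ t ] (8 * t + 1 ≡ x * x × (∀ h → t ≤ h → t ∈ trianglesUpTo h)) → ∃[ z ] (IsSplitting n z × Squared z (x , y))
    assemble (t , x² , t∈) = finish (square-pentagonal y y²%6)
      where
      expand : ∀ t b → 3 * (8 * t + 1) + 4 * b ≡ 3 + 4 * (6 * t + b)
      expand = solve-∀
      expand′ : ∀ n → 24 * n + 7 ≡ 3 + 4 * (6 * n + 1)
      expand′ = solve-∀
      -- Substituting x² = 8t + 1, subtracting 3 and dividing by 4; modulo 6 this yields y² ≡ 1.
      y²≡ : 6 * t + y * y ≡ 6 * n + 1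
      y²≡ = *-cancelˡ-≡ _ _ 4 (+-cancelˡ-≡ 3 _ _ (trans (sym (expand t (y * y)))
              (trans (cong (λ a → 3 * a + 4 * (y * y)) x²) (trans eq (expand′ n)))))
      y²%6 : (y * y) % 6 ≡ 1
      y²%6 = begin
        (y * y) % 6            ≡⟨ [m+kn]%n≡m%n (y * y) t 6 ⟨
        (y * y + t * 6) % 6    ≡⟨ cong (_% 6) (trans (+-comm (y * y) (t * 6)) (cong (_+ y * y) (*-comm t 6))) ⟩
        (6 * t + y * y) % 6    ≡⟨ cong (_% 6) (trans y²≡ (trans (+-comm (6 * n) 1) (cong (1 +_) (*-comm 6 n)))) ⟩
        (1 + n * 6) % 6        ≡⟨ [m+kn]%n≡m%n 1 n 6 ⟩
        1                      ∎
        where open ≡-Reasoning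
      finish : ∃[ e ] (24 * e + 1 ≡ y * y × (∀ h → e ≤ h → e ∈ pentagonals h)) → ∃[ z ] (IsSplitting n z × Squared z (x , y))
      finish (e , y² , e∈) = (t , e) , ((t∈ (4 * n) (≤-trans t≤n (m≤n*m n 4)) , e∈ n e≤n) , sum) , x² , y²
        where
        regroup : ∀ t e → 6 * (t + 4 * e) + 1 ≡ 6 * t + (24 * e + 1)
        regroup = solve-∀
        sum : t + 4 * e ≡ n
        sum = *-cancelˡ-≡ _ _ 6 (+-cancelʳ-≡ 1 _ _ (trans (regroup t e) (trans (cong (6 * t +_) y²) y²≡)))
        t≤n : t ≤ n
        t≤n = ≤-trans (m≤m+n t (4 * e)) (≤-reflexive sum)
        e≤n : e ≤ n
        e≤n = ≤-trans (m≤n*m e 4) (≤-trans (m≤n+m (4 * e) t) (≤-reflexive sum))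

-- The chain of parities from b₈(n) to the small divisors of 24n + 7

smallDivisors : ∀ N → NonZero N → Enumeration (SmallDivisor N)
smallDivisors N N≢0 = enumeration-⇔ (restrict (below (suc N)) (λ d → (d ∣? N) ×-dec (d * d <? N))) proj₂
  (λ s → s≤s (∣⇒≤ {{N≢0}} (proj₁ s)) , s)

odd⇔%2 : ∀ k → (k % 2 ≡ 1) ⇔ (oddℕ k ≡ true)
odd⇔%2 k = mk⇔ (to k) (from k)
  where
  to : ∀ k → k % 2 ≡ 1 → oddℕ k ≡ true
  to 1             _ = refl
  to (suc (suc k)) p = trans (not-involutive (oddℕ k)) (to k p)
  from : ∀ k → oddℕ k ≡ true → k % 2 ≡ 1
  from 1             _ = refl
  from (suc (suc k)) p = from k (trans (sym (not-involutive (oddℕ k))) p)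

theorem1p1 : (n : ℕ) → .{{_ : NonZero n}} →
    (b8 n % 2 ≡ 1) ⇔
    (∃[ p ] ∃[ m ] ∃[ a ]
    (Prime p × m ≥ 1 × ¬ (p ∣ m) × 24 * n + 7 ≡ p ^ (4 * a + 1) * m ^ 2))
theorem1p1 n = mk⇔
  (λ odd → Equivalence.to divisors-side (trans (sym parities) (Equivalence.to (odd⇔%2 (b8 n)) odd)))
  (λ form → Equivalence.from (odd⇔%2 (b8 n)) (trans parities (Equivalence.from divisors-side form)))
  where
  N≢0 : NonZero (24 * n + 7)
  N≢0 = subst NonZero (+-comm 7 (24 * n)) _
  E : Enumeration (SmallDivisor (24 * n + 7))
  E = smallDivisors (24 * n + 7) N≢0
  divisors-side : parity E ≡ true ⇔ (∃[ p ] ∃[ m ] ∃[ a ] (Prime p × m ≥ 1 × ¬ (p ∣ m) × 24 * n + 7 ≡ p ^ (4 * a + 1) * m ^ 2))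
  divisors-side = smallDivisors-odd n E
  parities : oddℕ (b8 n) ≡ parity E
  parities = begin
    oddℕ (b8 n)                   ≡⟨ b8-splittings n ⟩
    parity (splittings n)         ≡⟨ splittings-parity n ⟩
    parity (representations n)    ≡⟨ representations-parity n (representations n) ⟨
    parity (solutions n)          ≡⟨ smallDivisors-parity n E ⟩
    parity E                      ∎
    where open ≡-Reasoning
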